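{- Consider the algorithm OPTIMISTIC for the $k$-secretary problem with $k=2$, with sampling threshold $t$ satisfying $t-1 = cn$ where $c = 0.3521$. Then OPTIMISTIC is $0.4168$-competitive, i.e., for every item set, $\mathbb{E}[\mathrm{ALG}] \ge (0.4168 - o(1)) \cdot \mathrm{OPT}$, where $o(1)$ denotes a term tending to $0$ as $n \to \infty$.
   Context: $k$-secretary problem: there are $n$ items with distinct positive values $v_1 > v_2 > \dots > v_n$. The items arrive one by one in an order given by a permutation drawn uniformly at random among all $n!$ permutations. An algorithm may accept at most $k$ items; each decision is made immediately and irrevocably on arrival. $\mathrm{ALG}$ is the sum of accepted values and $\mathrm{OPT} = \sum_{i=1}^k v_i$. OPTIMISTIC with sampling threshold $t$ (integer, $k < t \le n-k$): reject the first $t-1$ items; let $s_1 > \dots > s_k$ be the $k$ best among them. In the selection phase (positions $\ge t$), the $j$-th accepted item is the first item arriving after the $(j-1)$-th accepted item (or after the sampling phase, for $j=1$) that is better than $s_{k-j+1}$; i.e., the algorithm first waits for an item better than $s_k$, then for a subsequent item better than $s_{k-1}$, and so on. Here cn is assumed to be an integer.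
   Formalization: The item values are taken to be rational numbers rather than arbitrary positive reals. -}

module Defs where

open import Data.Nat as ℕ using (ℕ; zero; suc; _!; _∸_)
open import Data.Nat.Properties using (_!≢0)
open import Data.Integer using (+_)
open import Data.Fin as Fin using (Fin)
open import Data.Fin.Properties using (≤-decTotalOrder)
open import Data.List using (List; []; _∷_; take; drop; reverse; concatMap; allFin; map; foldr)
open import Data.Rational as ℚ using (ℚ; 0ℚ)
open import Relation.Nullary using (yes; no)

insertions : {A : Set} → A → List A → List (List A)
insertions x [] = (x ∷ []) ∷ []
insertions x (y ∷ ys) = (x ∷ y ∷ ys) ∷ map (y ∷_) (insertions x ys)

permutations : {A : Set} → List A → List (List A)
permutations [] = [] ∷ []
permutations (x ∷ xs) = concatMap (insertions x) (permutations xs)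

-- An arrival order of the n items: a permutation of Fin n, read as the
-- sequence of arriving items (item i has value v i, v_0 > v_1 > ...).
arrivalOrders : (n : ℕ) → List (List (Fin n))
arrivalOrders n = permutations (allFin n)

sumℚ : List ℚ → ℚ
sumℚ = foldr ℚ._+_ 0ℚ

StrictlyDecreasing : {n : ℕ} → (Fin n → ℚ) → Set
StrictlyDecreasing {n} v = ∀ (i j : Fin n) → i Fin.< j → v j ℚ.< v i

Positive : {n : ℕ} → (Fin n → ℚ) → Set
Positive {n} v = ∀ (i : Fin n) → 0ℚ ℚ.< v i

module _ {n : ℕ} where
  open import Data.List.Sort.InsertionSort (≤-decTotalOrder n) using (sort)

  -- Selection phase.  First argument: remaining thresholds, in the order
  -- they are used (s_k, s_{k-1}, ..., s_1).  Item x is better than item s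
  -- iff x has smaller index (since v is strictly decreasing).
  select : List (Fin n) → List (Fin n) → List (Fin n)
  select [] _ = []
  select (_ ∷ _) [] = []
  select (s ∷ ss) (x ∷ xs) with x Fin.<? s
  ... | yes _ = x ∷ select ss xs
  ... | no _ = select (s ∷ ss) xs

  -- OPTIMISTIC with k slots and sampling threshold t: reject the first t-1
  -- items, let s_1 > ... > s_k be the k best of them (sorted by index,
  -- best first), then wait for an item better than s_k, then for a
  -- subsequent one better than s_{k-1}, etc.  Returns the accepted items.
  optimistic : (k t : ℕ) → List (Fin n) → List (Fin n)
  optimistic k t σ =
    select (reverse (take k (sort (take (t ∸ 1) σ)))) (drop (t ∸ 1) σ)

ALG : {n : ℕ} → (Fin n → ℚ) → (k t : ℕ) → List (Fin n) → ℚ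
ALG v k t σ = sumℚ (map v (optimistic k t σ))

expectedALG : (n : ℕ) → (Fin n → ℚ) → (k t : ℕ) → ℚ
expectedALG n v k t =
  ℚ._*_ (ℚ._/_ (+ 1) (n !) {{n !≢0}})
        (sumℚ (map (ALG v k t) (arrivalOrders n)))

OPT : {n : ℕ} → (Fin n → ℚ) → ℕ → ℚ
OPT {n} v k = sumℚ (map v (take k (allFin n)))

{-# OPTIONS --safe #-}

-- Build a random order by inserting the items from worst to best.  Whether the
-- best, respectively second best, of n items is accepted then depends only on
-- its position and on three events about a shorter random order: the best of
-- the first a items is sampled; in addition the two best of the first b are
-- sampled; at most one of the first a items is accepted.  With sample size m
-- and H = 1/m + … + 1/(n−1), the resulting recursions have closed solutions
--   Pr[second best accepted] = (m/n) H,
--   Pr[best accepted] = (m/n) (H + 1 − (m−1)/(n−1) (H + 1 + 1/(m−1) − 1/(n−1))).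
-- For m/n = 0.3521 the first exceeds 0.36, the second 0.4168, and their sum
-- 2 · 0.4168, for every n; as v₁ ≥ v₂, this gives the ratio 0.4168.
module Submission where

open import Defs
open import Data.Nat as ℕ using (ℕ; zero; suc; z≤n; s≤s; _!)
open import Data.Nat.Properties as ℕ using (_!≢0)
open import Data.Nat.Coprimality using (Coprime; coprime?; coprime-divisor)
open import Data.Nat.DivMod using (m/n*n≤m)
open import Data.Nat.Divisibility using (divides)
open import Data.Integer as ℤ using (+_)
import Data.Integer.Properties as ℤ
open import Data.Rational as ℚ using (ℚ; 0ℚ; 1ℚ; _+_; _*_; _-_; -_; _≤_; _<_)
import Data.Rational.Properties as ℚ
import Data.Rational.Unnormalised as ℚᵘ
import Data.Rational.Unnormalised.Properties as ℚᵘ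
open import Data.Rational.Solver using (module +-*-Solver)
open import Data.Fin as Fin using (Fin; zero; suc)
import Data.Fin.Properties as Fin
open import Data.List using (List; []; _∷_; _++_; map; concatMap; length; take; drop; allFin)
open import Data.List.Properties using (take-take; length-drop; length-tabulate)
open import Data.List.Membership.Propositional using (_∈_)
open import Data.List.Membership.Propositional.Properties using (∈-allFin)
open import Data.List.Relation.Binary.Permutation.Propositional using (_↭_; ↭-refl; ↭-sym; ↭-trans; prep; swap)
open import Data.List.Relation.Binary.Permutation.Propositional.Properties using (All-resp-↭; ∈-resp-↭; ↭-length)
open import Data.List.Relation.Unary.All as All using (All; []; _∷_)
open import Data.List.Relation.Unary.All.Properties using (map⁺; concat⁺; take⁺; drop⁺)
open import Data.List.Relation.Unary.AllPairs using (AllPairs; []; _∷_)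
open import Data.List.Relation.Unary.AllPairs.Properties using (tabulate⁺-<)
open import Data.List.Relation.Unary.Any using (here; there)
open import Data.Product using (_×_; _,_; ∃-syntax)
open import Data.Sum using (_⊎_; inj₁; inj₂)
open import Data.Unit using (⊤; tt)
open import Function using (_∘_; id)
open import Relation.Nullary using (yes; no; contradiction)
open import Relation.Nullary.Decidable using (dec-true; dec-false; from-yes)
open import Relation.Binary.PropositionalEquality

-- `permutations` inserts the head of a list, here always its best item, at every position of every
-- order of the rest. Conditioning on the position of the best item is therefore the one
-- probabilistic tool, and removing that item turns each of the three events into a simpler one or
-- into a certainty. Each event depends only on the sample and a fixed number of later arrivals, so
-- its probability is the same however many items follow. Only lower bounds are propagated: a
-- position about which nothing is claimed gets weight 0, so neither disjointness nor exactness has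
-- to be shown. The constants leave little room: the bounds for the two items are about 0.4662 and
-- 0.3675, with sum 0.83367 against 0.8336, so H is needed to within about 10⁻⁴. Its limit
-- ln(1/0.3521) = 1.0438... is no object of ℚ. Instead, n is a multiple of 10000, and comparing H in
-- blocks of n/10000 terms with 1/3522 + ... + 1/10000 reduces all n to a single numerical
-- evaluation.

-- Naturals and their reciprocals as rationals

opaque
  -- Opaque, so that type checking never normalises these fractions by a gcd; later reasoning about
  -- them goes through the laws of this block.
  ι : ℕ → ℚ
  ι n = + n ℚ./ 1

  inv : ℕ → ℚ
  inv n = + 1 ℚ./ suc n

  /-*-comm : ∀ i n j → (i ℚ./ suc n) * (j ℚ./ 1) ≡ (i ℤ.* j) ℚ./ suc n
  /-*-comm i n j = ℚ.toℚᵘ-injective (begin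
    ℚ.toℚᵘ ((i ℚ./ suc n) * (j ℚ./ 1))         ≈⟨ ℚ.toℚᵘ-homo-* (i ℚ./ suc n) (j ℚ./ 1) ⟩
    ℚ.toℚᵘ (i ℚ./ suc n) ℚᵘ.* ℚ.toℚᵘ (j ℚ./ 1) ≈⟨ ℚᵘ.*-cong (ℚ.toℚᵘ-fromℚᵘ (ℚᵘ.mkℚᵘ i n)) (ℚ.toℚᵘ-fromℚᵘ (ℚᵘ.mkℚᵘ j 0)) ⟩
    ℚᵘ.mkℚᵘ i n ℚᵘ.* ℚᵘ.mkℚᵘ j 0               ≈⟨ ℚᵘ.*≡* (cong (i ℤ.* j ℤ.*_) (cong (λ d → + suc d) (sym (ℕ.*-identityʳ n)))) ⟩
    ℚᵘ.mkℚᵘ (i ℤ.* j) n                        ≈⟨ ℚ.toℚᵘ-fromℚᵘ (ℚᵘ.mkℚᵘ (i ℤ.* j) n) ⟨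
    ℚ.toℚᵘ ((i ℤ.* j) ℚ./ suc n)               ∎)
    where
    open ℚᵘ.≃-Reasoning

  ι-+ : ∀ m n → ι (m ℕ.+ n) ≡ ι m + ι n
  ι-+ m n = ℚ.toℚᵘ-injective (begin
    ℚ.toℚᵘ (ι (m ℕ.+ n))                 ≈⟨ ℚ.toℚᵘ-fromℚᵘ (ℚᵘ.mkℚᵘ (+ (m ℕ.+ n)) 0) ⟩
    ℚᵘ.mkℚᵘ (+ (m ℕ.+ n)) 0              ≈⟨ ℚᵘ.*≡* (cong (ℤ._* + 1) (cong₂ ℤ._+_ (sym (ℤ.*-identityʳ (+ m))) (sym (ℤ.*-identityʳ (+ n))))) ⟩
    ℚᵘ.mkℚᵘ (+ m) 0 ℚᵘ.+ ℚᵘ.mkℚᵘ (+ n) 0 ≈⟨ ℚᵘ.+-cong (ℚ.toℚᵘ-fromℚᵘ (ℚᵘ.mkℚᵘ (+ m) 0)) (ℚ.toℚᵘ-fromℚᵘ (ℚᵘ.mkℚᵘ (+ n) 0)) ⟨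
    ℚ.toℚᵘ (ι m) ℚᵘ.+ ℚ.toℚᵘ (ι n)       ≈⟨ ℚ.toℚᵘ-homo-+ (ι m) (ι n) ⟨
    ℚ.toℚᵘ (ι m + ι n)                   ∎)
    where
    open ℚᵘ.≃-Reasoning

  ι-* : ∀ m n → ι (m ℕ.* n) ≡ ι m * ι n
  ι-* m n = trans (cong (ℚ._/ 1) (ℤ.pos-* m n)) (sym (/-*-comm (+ m) 0 (+ n)))

  ι-suc : ∀ n → ι (suc n) ≡ 1ℚ + ι n
  ι-suc n = ι-+ 1 n

  ι-inv : ∀ n → ι (suc n) * inv n ≡ 1ℚ
  ι-inv n = trans (ℚ.*-comm (ι (suc n)) (inv n)) (trans (/-*-comm (+ 1) n (+ suc n))
    (ℚ.toℚᵘ-injective (ℚᵘ.≃-trans (ℚ.toℚᵘ-fromℚᵘ (ℚᵘ.mkℚᵘ (+ 1 ℤ.* + suc n) n)) (ℚᵘ.*≡* eq))))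
    where
    eq : (+ 1 ℤ.* + suc n) ℤ.* + 1 ≡ + 1 ℤ.* + suc n
    eq = ℤ.*-identityʳ _

  ι-nonNeg : ∀ n → ℚ.NonNegative (ι n)
  ι-nonNeg n = ℚ.normalize-nonNeg n 1

  inv-nonNeg : ∀ n → ℚ.NonNegative (inv n)
  inv-nonNeg n = ℚ.normalize-nonNeg 1 (suc n)

  ι-zero : ι 0 ≡ 0ℚ
  ι-zero = refl

  ι-one : ι 1 ≡ 1ℚ
  ι-one = refl

  /-ι : ∀ i n → + i ℚ./ suc n ≡ inv n * ι i
  /-ι i n = sym (trans (/-*-comm (+ 1) n (+ i)) (cong (ℚ._/ suc n) (ℤ.*-identityˡ (+ i))))

  1/≡inv : ∀ n → + 1 ℚ./ suc n ≡ inv n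
  1/≡inv n = refl

  ι-mono : ∀ {m n} → m ℕ.≤ n → ι m ≤ ι n
  ι-mono {m} {n} m≤n = subst (ι m ≤_) (trans (sym (ι-+ m (n ℕ.∸ m))) (cong ι (ℕ.m+[n∸m]≡n m≤n)))
    (subst (_≤ ι m + ι (n ℕ.∸ m)) (ℚ.+-identityʳ (ι m))
      (ℚ.+-monoʳ-≤ (ι m) (ℚ.nonNegative⁻¹ (ι (n ℕ.∸ m)) {{ι-nonNeg (n ℕ.∸ m)}})))

-- Sums over initial segments

Σ< : ℕ → (ℕ → ℚ) → ℚ
Σ< zero    f = 0ℚ
Σ< (suc n) f = Σ< n f + f n

Σ<-cong : ∀ n {f g : ℕ → ℚ} → (∀ i → i ℕ.< n → f i ≡ g i) → Σ< n f ≡ Σ< n g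
Σ<-cong zero    eq = refl
Σ<-cong (suc n) eq = cong₂ _+_ (Σ<-cong n (λ i i<n → eq i (ℕ.m<n⇒m<1+n i<n))) (eq n (ℕ.n<1+n n))

Σ<-mono-≤ : ∀ n {f g : ℕ → ℚ} → (∀ i → i ℕ.< n → f i ≤ g i) → Σ< n f ≤ Σ< n g
Σ<-mono-≤ zero    le = ℚ.≤-refl
Σ<-mono-≤ (suc n) le = ℚ.+-mono-≤ (Σ<-mono-≤ n (λ i i<n → le i (ℕ.m<n⇒m<1+n i<n))) (le n (ℕ.n<1+n n))

Σ<-suc : ∀ n f → Σ< (suc n) f ≡ f 0 + Σ< n (f ∘ suc)
Σ<-suc zero    f = ℚ.+-comm 0ℚ (f 0)
Σ<-suc (suc n) f = trans (cong (_+ f (suc n)) (Σ<-suc n f)) (ℚ.+-assoc (f 0) _ _)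

Σ<-+ : ∀ m k f → Σ< (m ℕ.+ k) f ≡ Σ< m f + Σ< k (λ i → f (m ℕ.+ i))
Σ<-+ m zero    f = trans (cong (λ n → Σ< n f) (ℕ.+-identityʳ m)) (sym (ℚ.+-identityʳ _))
Σ<-+ m (suc k) f = trans (cong (λ n → Σ< n f) (ℕ.+-suc m k))
  (trans (cong (_+ f (m ℕ.+ k)) (Σ<-+ m k f)) (ℚ.+-assoc (Σ< m f) _ _))

Σ<-distrib-+ : ∀ n f g → Σ< n (λ i → f i + g i) ≡ Σ< n f + Σ< n g
Σ<-distrib-+ zero    f g = refl
Σ<-distrib-+ (suc n) f g = trans (cong (_+ (f n + g n)) (Σ<-distrib-+ n f g))
  (solve 4 (λ a b c d → (a :+ b) :+ (c :+ d) := (a :+ c) :+ (b :+ d)) refl (Σ< n f) (Σ< n g) (f n) (g n))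
  where
  open +-*-Solver

*-distribˡ-Σ< : ∀ n c f → Σ< n (λ i → c * f i) ≡ c * Σ< n f
*-distribˡ-Σ< zero    c f = sym (ℚ.*-zeroʳ c)
*-distribˡ-Σ< (suc n) c f = trans (cong (_+ c * f n) (*-distribˡ-Σ< n c f)) (sym (ℚ.*-distribˡ-+ c _ _))

Σ<-const : ∀ n c → Σ< n (λ _ → c) ≡ ι n * c
Σ<-const zero    c = sym (trans (cong (_* c) ι-zero) (ℚ.*-zeroˡ c))
Σ<-const (suc n) c = begin
  Σ< n (λ _ → c) + c ≡⟨ cong (_+ c) (Σ<-const n c) ⟩
  ι n * c + c        ≡⟨ solve 2 (λ a b → a :* b :+ b := (con 1ℚ :+ a) :* b) refl (ι n) c ⟩
  (1ℚ + ι n) * c     ≡⟨ cong (_* c) (ι-suc n) ⟨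
  ι (suc n) * c      ∎
  where
  open ≡-Reasoning
  open +-*-Solver

-- Weights for the position of an inserted item: the pieces meet where the sample or a prefix ends,
-- and the second is indexed from there.
glue : ℕ → (ℕ → ℚ) → (ℕ → ℚ) → ℕ → ℚ
glue zero    f g b       = g b
glue (suc m) f g zero    = f 0
glue (suc m) f g (suc b) = glue m (f ∘ suc) g b

-- `P` sees both position and weight, so a family of `Likely` bounds can be assembled piece by
-- piece.
glue-elim : ∀ m {k} {f g : ℕ → ℚ} (P : ℕ → ℚ → Set) → (∀ b → b ℕ.< m → P b (f b)) →
            (∀ i → i ℕ.< k → P (m ℕ.+ i) (g i)) → ∀ b → b ℕ.< m ℕ.+ k → P b (glue m f g b)
glue-elim zero    P l r b       b<         = r b b<
glue-elim (suc m) P l r zero    b<         = l 0 ℕ.z<s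
glue-elim (suc m) P l r (suc b) (ℕ.s≤s b<) = glue-elim m (P ∘ suc) (λ b b<m → l (suc b) (ℕ.s<s b<m)) r b b<

Σ<-glue : ∀ m k f g → Σ< (m ℕ.+ k) (glue m f g) ≡ Σ< m f + Σ< k g
Σ<-glue zero    k f g = sym (ℚ.+-identityˡ _)
Σ<-glue (suc m) k f g = begin
  Σ< (suc (m ℕ.+ k)) (glue (suc m) f g)   ≡⟨ Σ<-suc (m ℕ.+ k) (glue (suc m) f g) ⟩
  f 0 + Σ< (m ℕ.+ k) (glue m (f ∘ suc) g) ≡⟨ cong (_+_ (f 0)) (Σ<-glue m k (f ∘ suc) g) ⟩
  f 0 + (Σ< m (f ∘ suc) + Σ< k g)         ≡⟨ ℚ.+-assoc (f 0) _ _ ⟨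
  f 0 + Σ< m (f ∘ suc) + Σ< k g           ≡⟨ cong (_+ Σ< k g) (Σ<-suc m f) ⟨
  Σ< (suc m) f + Σ< k g                   ∎
  where
  open ≡-Reasoning

-- Sums over all permutations

module _ {A : Set} where

  -- A position past the end appends, so positions carry no bound in their type.
  ins : ℕ → A → List A → List A
  ins zero    x ys       = x ∷ ys
  ins (suc b) x []       = x ∷ []
  ins (suc b) x (y ∷ ys) = y ∷ ins b x ys

  ins-↭ : ∀ b x ys → ins b x ys ↭ x ∷ ys
  ins-↭ zero    x ys       = ↭-refl
  ins-↭ (suc b) x []       = ↭-refl
  ins-↭ (suc b) x (y ∷ ys) = ↭-trans (prep y (ins-↭ b x ys)) (swap y x ↭-refl)

  sumOver : List (List A) → (List A → ℚ) → ℚ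
  sumOver L f = sumℚ (map f L)

  sumOver-++ : ∀ K L f → sumOver (K ++ L) f ≡ sumOver K f + sumOver L f
  sumOver-++ []      L f = sym (ℚ.+-identityˡ _)
  sumOver-++ (x ∷ K) L f = trans (cong (_+_ (f x)) (sumOver-++ K L f)) (sym (ℚ.+-assoc (f x) _ _))

  sumOver-map : ∀ (g : List A → List A) L f → sumOver (map g L) f ≡ sumOver L (f ∘ g)
  sumOver-map g []      f = refl
  sumOver-map g (x ∷ L) f = cong (_+_ (f (g x))) (sumOver-map g L f)

  sumOver-insertions : ∀ x ys f → sumOver (insertions x ys) f ≡ Σ< (suc (length ys)) (λ b → f (ins b x ys))
  sumOver-insertions x []       f = ℚ.+-comm (f (x ∷ [])) 0ℚ
  sumOver-insertions x (y ∷ ys) f = begin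
    f (x ∷ y ∷ ys) + sumOver (map (y ∷_) (insertions x ys)) f        ≡⟨ cong (_+_ (f (x ∷ y ∷ ys))) (sumOver-map (y ∷_) (insertions x ys) f) ⟩
    f (x ∷ y ∷ ys) + sumOver (insertions x ys) (f ∘ (y ∷_))          ≡⟨ cong (_+_ (f (x ∷ y ∷ ys))) (sumOver-insertions x ys (f ∘ (y ∷_))) ⟩
    f (x ∷ y ∷ ys) + Σ< (suc (length ys)) (λ b → f (y ∷ ins b x ys)) ≡⟨ Σ<-suc (suc (length ys)) (λ b → f (ins b x (y ∷ ys))) ⟨
    Σ< (suc (suc (length ys))) (λ b → f (ins b x (y ∷ ys)))          ∎
    where
    open ≡-Reasoning

  sumOver-concatMap-insertions : ∀ x N L f → All (λ ρ → length ρ ≡ N) L →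
    sumOver (concatMap (insertions x) L) f ≡ Σ< (suc N) (λ b → sumOver L (f ∘ ins b x))
  sumOver-concatMap-insertions x N []      f []          =
    sym (trans (Σ<-const (suc N) 0ℚ) (ℚ.*-zeroʳ (ι (suc N))))
  sumOver-concatMap-insertions x N (ρ ∷ L) f (refl ∷ ls) = begin
    sumOver (insertions x ρ ++ concatMap (insertions x) L) f
      ≡⟨ sumOver-++ (insertions x ρ) _ f ⟩
    sumOver (insertions x ρ) f + sumOver (concatMap (insertions x) L) f
      ≡⟨ cong₂ _+_ (sumOver-insertions x ρ f) (sumOver-concatMap-insertions x N L f ls) ⟩
    Σ< (suc N) (λ b → f (ins b x ρ)) + Σ< (suc N) (λ b → sumOver L (f ∘ ins b x))
      ≡⟨ Σ<-distrib-+ (suc N) _ _ ⟨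
    Σ< (suc N) (λ b → f (ins b x ρ) + sumOver L (f ∘ ins b x)) ∎
    where
    open ≡-Reasoning

  insertions-length : ∀ (x : A) ys → All (λ (ρ : List A) → length ρ ≡ suc (length ys)) (insertions x ys)
  insertions-length x []       = refl ∷ []
  insertions-length x (y ∷ ys) = refl ∷ map⁺ (All.map (cong suc) (insertions-length x ys))

  permutations-length : ∀ (xs : List A) → All (λ (ρ : List A) → length ρ ≡ length xs) (permutations xs)
  permutations-length []       = refl ∷ []
  permutations-length (x ∷ xs) = concat⁺ (map⁺ (All.map ins-len (permutations-length xs)))
    where
    ins-len : ∀ {ρ} → length ρ ≡ length xs → All (λ σ → length σ ≡ suc (length xs)) (insertions x ρ)
    ins-len {ρ} eq = subst (λ n → All (λ σ → length σ ≡ suc n) (insertions x ρ)) eq (insertions-length x ρ)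

  -- The source of all recursions: a random order is a random order of the rest together with an
  -- independent uniform position of the head.
  sumOver-permutations-∷ : ∀ x xs f →
    sumOver (permutations (x ∷ xs)) f ≡ Σ< (suc (length xs)) (λ b → sumOver (permutations xs) (f ∘ ins b x))
  sumOver-permutations-∷ x xs f =
    sumOver-concatMap-insertions x (length xs) (permutations xs) f (permutations-length xs)

  sumOver-mono : ∀ L {f g} → (∀ ρ → f ρ ≤ g ρ) → sumOver L f ≤ sumOver L g
  sumOver-mono []      le = ℚ.≤-refl
  sumOver-mono (ρ ∷ L) le = ℚ.+-mono-≤ (le ρ) (sumOver-mono L le)

  sumOver-distrib-+ : ∀ L f g → sumOver L (λ ρ → f ρ + g ρ) ≡ sumOver L f + sumOver L g
  sumOver-distrib-+ []      f g = refl
  sumOver-distrib-+ (ρ ∷ L) f g = trans (cong (_+_ (f ρ + g ρ)) (sumOver-distrib-+ L f g))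
    (solve 4 (λ a b c d → (a :+ b) :+ (c :+ d) := (a :+ c) :+ (b :+ d)) refl (f ρ) (g ρ) (sumOver L f) (sumOver L g))
    where
    open +-*-Solver

  *-distribˡ-sumOver : ∀ L c f → sumOver L (λ ρ → c * f ρ) ≡ c * sumOver L f
  *-distribˡ-sumOver []      c f = sym (ℚ.*-zeroʳ c)
  *-distribˡ-sumOver (ρ ∷ L) c f = trans (cong (_+_ (c * f ρ)) (*-distribˡ-sumOver L c f)) (sym (ℚ.*-distribˡ-+ c _ _))

-- Lower bounds for probabilities

module _ {n : ℕ} where

  Event : Set₁
  Event = List (Fin n) → Set

  -- At least a fraction π of the orders of any N items satisfies E; counting
  -- is against arbitrary majorants f of the indicator of E, so that E need not
  -- be decidable.
  Likely : ℕ → Event → ℚ → Set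
  Likely N E π = ∀ xs → AllPairs Fin._<_ xs → length xs ≡ N → (f : List (Fin n) → ℚ) →
    (∀ ρ → 0ℚ ≤ f ρ) → (∀ ρ → ρ ↭ xs → E ρ → 1ℚ ≤ f ρ) → ι (N !) * π ≤ sumOver (permutations xs) f

  -- The inserted best item is quantified away, so that the result is again an event about any N
  -- items, as `Likely` requires.
  ins⁻ : ℕ → Event → Event
  ins⁻ b E ρ = ∀ x → All (x Fin.<_) ρ → E (ins b x ρ)

  Likely-mono : ∀ {N π} {E E′ : Event} → (∀ ρ → length ρ ≡ N → E ρ → E′ ρ) → Likely N E π → Likely N E′ π
  Likely-mono imp L xs xs↗ refl f f≥0 f≥1 =
    L xs xs↗ refl f f≥0 (λ ρ ρ↭ e → f≥1 ρ ρ↭ (imp ρ (↭-length ρ↭) e))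

  -- Condition on the position b of the best item.
  Likely-step : ∀ {N E π} (π′ : ℕ → ℚ) → (∀ b → b ℕ.< suc N → Likely N (ins⁻ b E) (π′ b)) →
                ι (suc N) * π ≡ Σ< (suc N) π′ → Likely (suc N) E π
  Likely-step {N} {E} {π} π′ L eq (x ∷ xs) (x< ∷ xs↗) refl f f≥0 f≥1 = begin
    ι (suc N !) * π                   ≡⟨ cong (_* π) (ι-* (suc N) (N !)) ⟩
    ι (suc N) * ι (N !) * π           ≡⟨ solve 3 (λ a b c → a :* b :* c := b :* (a :* c)) refl (ι (suc N)) (ι (N !)) π ⟩
    ι (N !) * (ι (suc N) * π)         ≡⟨ cong (ι (N !) *_) eq ⟩
    ι (N !) * Σ< (suc N) π′           ≡⟨ *-distribˡ-Σ< (suc N) (ι (N !)) π′ ⟨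
    Σ< (suc N) (λ b → ι (N !) * π′ b) ≤⟨ Σ<-mono-≤ (suc N) (λ b b< → L b b< xs xs↗ refl (f ∘ ins b x) (λ ρ → f≥0 _)
                                                                      (λ ρ ρ↭ e → f≥1 (ins b x ρ) (↭-trans (ins-↭ b x ρ) (prep x ρ↭))
                                                                        (e x (All-resp-↭ (↭-sym ρ↭) x<)))) ⟩
    Σ< (suc N) (λ b → sumOver (permutations xs) (f ∘ ins b x)) ≡⟨ sumOver-permutations-∷ x xs f ⟨
    sumOver (permutations (x ∷ xs)) f                          ∎
    where
    open ℚ.≤-Reasoning
    open +-*-Solver

  Likely-⊤ : ∀ N → Likely N (λ _ → ⊤) 1ℚ
  Likely-⊤ zero    [] _ refl f f≥0 f≥1 =
    ℚ.≤-trans (ℚ.≤-reflexive (trans (ℚ.*-identityʳ (ι 1)) ι-one))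
              (ℚ.≤-trans (f≥1 [] ↭-refl tt) (ℚ.≤-reflexive (sym (ℚ.+-identityʳ (f [])))))
  Likely-⊤ (suc N) = Likely-step {N} (λ _ → 1ℚ) (λ b _ → Likely-mono (λ _ _ _ _ _ → tt) (Likely-⊤ N))
    (sym (Σ<-const (suc N) 1ℚ))

  -- The default for positions at which nothing is claimed.
  Likely-0 : ∀ N {E} → Likely N E 0ℚ
  Likely-0 N xs _ _ f f≥0 _ = ℚ.≤-trans (ℚ.≤-reflexive (ℚ.*-zeroʳ (ι (N !)))) (sum≥0 (permutations xs))
    where
    sum≥0 : ∀ L → 0ℚ ≤ sumOver L f
    sum≥0 []      = ℚ.≤-refl
    sum≥0 (ρ ∷ L) = ℚ.+-mono-≤ (f≥0 ρ) (sum≥0 L)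

  -- An event fixed by the first a + 1 positions has a probability independent of N. By induction on
  -- the excess d, a new best item inside the prefix contributes the same weights `π′` as before,
  -- whose sum is (a + 1) π; each of the d + 1 positions behind it preserves the event and
  -- contributes π.
  Likely-prefix : ∀ a {E π} (π′ : ℕ → ℚ) →
    (∀ i {x ρ} → suc a ℕ.≤ length ρ → E ρ → E (ins (suc a ℕ.+ i) x ρ)) →
    (∀ N → a ℕ.≤ N → ∀ b → b ℕ.< suc a → Likely N (ins⁻ b E) (π′ b)) →
    ι (suc a) * π ≡ Σ< (suc a) π′ → ∀ N → suc a ℕ.≤ N → Likely N E π
  Likely-prefix a {E} {π} π′ local L eq K a<K =
    subst (λ N → Likely N E π) (ℕ.m∸n+n≡m a<K) (by-excess (K ℕ.∸ suc a))
    where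
    by-excess : ∀ d → Likely (d ℕ.+ suc a) E π
    by-excess zero    = Likely-step π′ (L a ℕ.≤-refl) eq
    by-excess (suc d) = Likely-step {N} π″ bound total
      where
      N = d ℕ.+ suc a
      π″ = glue (suc a) π′ (λ _ → π)
      a≤N : suc a ℕ.≤ N
      a≤N = ℕ.m≤n+m (suc a) d
      sucN : suc N ≡ suc a ℕ.+ suc d
      sucN = ℕ.+-comm (suc d) (suc a)
      bound : ∀ b → b ℕ.< suc N → Likely N (ins⁻ b E) (π″ b)
      bound b b< = glue-elim (suc a) (λ b → Likely N (ins⁻ b E)) (L N (ℕ.<⇒≤ a≤N))
        (λ i _ → Likely-mono (λ ρ len e x _ → local i (ℕ.≤-trans a≤N (ℕ.≤-reflexive (sym len))) e) (by-excess d))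
        b (subst (b ℕ.<_) sucN b<)
      total : ι (suc N) * π ≡ Σ< (suc N) π″
      total = begin
        ι (suc N) * π                        ≡⟨ cong (λ n → ι n * π) sucN ⟩
        ι (suc a ℕ.+ suc d) * π              ≡⟨ cong (_* π) (ι-+ (suc a) (suc d)) ⟩
        (ι (suc a) + ι (suc d)) * π          ≡⟨ ℚ.*-distribʳ-+ π (ι (suc a)) (ι (suc d)) ⟩
        ι (suc a) * π + ι (suc d) * π        ≡⟨ cong₂ _+_ eq (sym (Σ<-const (suc d) π)) ⟩
        Σ< (suc a) π′ + Σ< (suc d) (λ _ → π) ≡⟨ Σ<-glue (suc a) (suc d) π′ (λ _ → π) ⟨
        Σ< (suc a ℕ.+ suc d) π″              ≡⟨ cong (λ n → Σ< n π″) sucN ⟨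
        Σ< (suc N) π″                        ∎
        where
        open ≡-Reasoning

-- Insertion against splitting into sample and arrivals

module _ {A : Set} where

  take-ins-≤ : ∀ {b m} (x : A) ρ → b ℕ.≤ m → take (suc m) (ins b x ρ) ≡ ins b x (take m ρ)
  take-ins-≤ x ρ       z≤n       = refl
  take-ins-≤ x []      (s≤s b≤m) = refl
  take-ins-≤ x (y ∷ ρ) (s≤s b≤m) = cong (y ∷_) (take-ins-≤ x ρ b≤m)

  drop-ins-≤ : ∀ {b m} (x : A) ρ → b ℕ.≤ m → drop (suc m) (ins b x ρ) ≡ drop m ρ
  drop-ins-≤ x ρ       z≤n       = refl
  drop-ins-≤ x []      (s≤s b≤m) = refl
  drop-ins-≤ x (y ∷ ρ) (s≤s b≤m) = drop-ins-≤ x ρ b≤m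

  take-ins-≥ : ∀ m i (x : A) ρ → m ℕ.≤ length ρ → take m (ins (m ℕ.+ i) x ρ) ≡ take m ρ
  take-ins-≥ zero    i x ρ       m≤       = refl
  take-ins-≥ (suc m) i x (y ∷ ρ) (s≤s m≤) = cong (y ∷_) (take-ins-≥ m i x ρ m≤)

  drop-ins-≥ : ∀ m i (x : A) ρ → m ℕ.≤ length ρ → drop m (ins (m ℕ.+ i) x ρ) ≡ ins i x (drop m ρ)
  drop-ins-≥ zero    i x ρ       m≤       = refl
  drop-ins-≥ (suc m) i x (y ∷ ρ) (s≤s m≤) = drop-ins-≥ m i x ρ m≤

  ins-split : ∀ i (y : A) t → ins i y t ≡ take i t ++ y ∷ drop i t
  ins-split zero    y t       = refl
  ins-split (suc i) y []      = refl
  ins-split (suc i) y (z ∷ t) = cong (z ∷_) (ins-split i y t)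

  -- Exposes what precedes the second best item y once the best item x is inserted. Here x joins the
  -- part before y; in `ins-ins->` it lands behind y and that part is unchanged.
  ins-ins-≤ : ∀ {j i} (x y : A) t → j ℕ.≤ i → i ℕ.≤ length t →
              ins j x (ins i y t) ≡ ins j x (take i t) ++ y ∷ drop i t
  ins-ins-≤ {i = i} x y t z≤n       i≤       = cong (x ∷_) (ins-split i y t)
  ins-ins-≤ x y (z ∷ t)   (s≤s j≤i) (s≤s i≤) = cong (z ∷_) (ins-ins-≤ x y t j≤i i≤)

  ins-ins-> : ∀ i l (x y : A) t → i ℕ.≤ length t →
              ins (suc i ℕ.+ l) x (ins i y t) ≡ take i t ++ y ∷ ins l x (drop i t)
  ins-ins-> zero    l x y t       i≤       = refl
  ins-ins-> (suc i) l x y (z ∷ t) (s≤s i≤) = cong (z ∷_) (ins-ins-> i l x y t i≤)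

  length-ins : ∀ b (x : A) ρ → length (ins b x ρ) ≡ suc (length ρ)
  length-ins b x ρ = ↭-length (ins-↭ b x ρ)

  drop-≤ : ∀ m {i} (ρ : List A) → m ℕ.+ i ℕ.≤ length ρ → i ℕ.≤ length (drop m ρ)
  drop-≤ m {i} ρ le = subst (_ ℕ.≤_) (sym (length-drop m ρ)) (ℕ.m+n≤o⇒m≤o∸n i (subst (ℕ._≤ length ρ) (ℕ.+-comm m i) le))

-- Runs of the algorithm

module _ {n : ℕ} where
  open import Data.List.Sort.InsertionSort (Fin.≤-decTotalOrder n) using (sort; insert; insertionSort)
  open import Data.List.Sort.Base (Fin.≤-totalOrder n) using (module SortingAlgorithm)
  open SortingAlgorithm insertionSort using (sort-↭)

  All-ins : ∀ {P : Fin n → Set} b {x ρ} → P x → All P ρ → All P (ins b x ρ)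
  All-ins b {x} {ρ} px pρ = All-resp-↭ (↭-sym (ins-↭ b x ρ)) (px ∷ pρ)

  All-sort : ∀ {P : Fin n → Set} m {ρ} → All P ρ → All P (sort (take m ρ))
  All-sort m {ρ} pρ = All-resp-↭ (↭-sym (sort-↭ (take m ρ))) (take⁺ m pρ)

  insert-min : ∀ {x : Fin n} {l} → All (x Fin.<_) l → insert x l ≡ x ∷ l
  insert-min []                      = refl
  insert-min {x} {y ∷ _} (x<y ∷ _) rewrite dec-true (x Fin.≤? y) (ℕ.<⇒≤ x<y) = refl

  insert-> : ∀ {x y : Fin n} {l} → x Fin.< y → insert y (x ∷ l) ≡ x ∷ insert y l
  insert-> {x} {y} x<y rewrite dec-false (y Fin.≤? x) (ℕ.<⇒≱ x<y) = refl

  sort-ins : ∀ b {x : Fin n} {ρ} → All (x Fin.<_) ρ → sort (ins b x ρ) ≡ x ∷ sort ρ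
  sort-ins zero    {ρ = ρ}     x<       = insert-min (All-resp-↭ (↭-sym (sort-↭ ρ)) x<)
  sort-ins (suc b) {ρ = []}    x<       = refl
  sort-ins (suc b) {ρ = y ∷ ρ} (x<y ∷ x<) = trans (cong (insert y) (sort-ins b x<)) (insert-> x<y)

  select-< : ∀ {s x : Fin n} ss xs → x Fin.< s → select (s ∷ ss) (x ∷ xs) ≡ x ∷ select ss xs
  select-< {s} {x} ss xs x<s with x Fin.<? s
  ... | yes _  = refl
  ... | no x≮s = contradiction x<s x≮s

  select-≮ : ∀ {s x : Fin n} ss xs → s Fin.< x → select (s ∷ ss) (x ∷ xs) ≡ select (s ∷ ss) xs
  select-≮ {s} {x} ss xs s<x with x Fin.<? s
  ... | yes x<s = contradiction x<s (ℕ.<⇒≯ s<x)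
  ... | no _    = refl

  select-none : ∀ {s : Fin n} ss {t} → All (s Fin.<_) t → select (s ∷ ss) t ≡ []
  select-none ss []         = refl
  select-none ss {_ ∷ t} (s<x ∷ s<) = trans (select-≮ ss t s<x) (select-none ss s<)

  select-skip : ∀ {s : Fin n} ss {pre} t → All (s Fin.<_) pre → select (s ∷ ss) (pre ++ t) ≡ select (s ∷ ss) t
  select-skip ss         t []         = refl
  select-skip ss {_ ∷ p} t (s<x ∷ s<) = trans (select-≮ ss (p ++ t) s<x) (select-skip ss t s<)

  -- Nothing before x meets the first threshold, so x takes the first slot; the next threshold s₁ is
  -- then met by no remaining item.
  select-ins : ∀ {s₁ s₂ x : Fin n} j {t} → x Fin.< s₂ → All (s₂ Fin.<_) (take j t) → All (s₁ Fin.<_) t →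
               select (s₂ ∷ s₁ ∷ []) (ins j x t) ≡ x ∷ []
  select-ins zero    {t} x<s₂ _ s₁<     = trans (select-< _ t x<s₂) (cong (_ ∷_) (select-none [] s₁<))
  select-ins (suc j) {[]} x<s₂ _ s₁<    = select-< _ [] x<s₂
  select-ins (suc j) {y ∷ t} x<s₂ (s₂<y ∷ s₂<) (_ ∷ s₁<) =
    trans (select-≮ _ (ins j _ t) s₂<y) (select-ins j x<s₂ s₂< s₁<)

  -- The second threshold is better than every arrival, so the second slot stays empty whatever s
  -- is.
  select-≤1 : ∀ {s x : Fin n} {t} → All (x Fin.<_) t → length (select (s ∷ x ∷ []) t) ℕ.≤ 1
  select-≤1 [] = z≤n
  select-≤1 {s} {x} {y ∷ t} (x<y ∷ x<) with y Fin.<? s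
  ... | yes _ rewrite select-none [] x< = ℕ.≤-refl
  ... | no _  = select-≤1 x<

  -- An item that beats all thresholds is accepted on arrival as long as a slot is free.
  select-∋ : ∀ {y : Fin n} {ss} pre {post} → All (y Fin.<_) ss → length (select ss pre) ℕ.< length ss →
             y ∈ select ss (pre ++ y ∷ post)
  select-∋ {y} {s ∷ ss} [] {post} (y<s ∷ _) _ = subst (y ∈_) (sym (select-< ss post y<s)) (here refl)
  select-∋ {y} {s ∷ ss} (z ∷ pre) (y<s ∷ y<) lt with z Fin.<? s
  ... | yes _ = there (select-∋ pre y< (ℕ.≤-pred lt))
  ... | no _  = select-∋ pre (y<s ∷ y<) lt

  -- Events seen only through the sorted sample and the next i arrivals. Inserting at a position
  -- from m + i on changes neither, which is the locality that `Likely-prefix` asks for.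
  Run : ℕ → ℕ → (List (Fin n) → List (Fin n) → Set) → Event {n}
  Run m i P ρ = P (sort (take m ρ)) (take i (drop m ρ))

  -- The three events, for a sorted sample and the items t that follow it.
  data Above : List (Fin n) → List (Fin n) → Set where
    above : ∀ {s r t} → All (s Fin.<_) t → Above (s ∷ r) t

  data Above₂ (j : ℕ) : List (Fin n) → List (Fin n) → Set where
    above₂ : ∀ {s₁ s₂ r t} → All (s₁ Fin.<_) t → All (s₂ Fin.<_) (take j t) → Above₂ j (s₁ ∷ s₂ ∷ r) t

  data AtMostOne : List (Fin n) → List (Fin n) → Set where
    atMostOne : ∀ {s₁ s₂ r t} → length (select (s₂ ∷ s₁ ∷ []) t) ℕ.≤ 1 → AtMostOne (s₁ ∷ s₂ ∷ r) t

  -- The best item is described by its rank within σ, not named, because the recursions run over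
  -- arbitrary increasing lists of items.
  BestAccepted : ℕ → Event {n}
  BestAccepted m σ = ∃[ x ] All (x Fin.≤_) σ × x ∈ optimistic 2 (suc m) σ

  SecondAccepted : ℕ → Event {n}
  SecondAccepted m σ = ∃[ x ] ∃[ y ] x Fin.< y × All (λ z → x ≡ z ⊎ y Fin.≤ z) σ × y ∈ optimistic 2 (suc m) σ

  Run-ins-sample : ∀ {m b i P x ρ} → b ℕ.≤ m → All (x Fin.<_) ρ →
                   P (x ∷ sort (take m ρ)) (take i (drop m ρ)) → Run (suc m) i P (ins b x ρ)
  Run-ins-sample {m} {b} {i} {P} {x} {ρ} b≤m x< p =
    subst₂ P (sym (trans (cong sort (take-ins-≤ x ρ b≤m)) (sort-ins b (take⁺ m x<))))
             (cong (take i) (sym (drop-ins-≤ x ρ b≤m))) p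

  Run-ins-after : ∀ {m j i P x ρ} → m ℕ.≤ length ρ → j ℕ.≤ i →
                  P (sort (take m ρ)) (ins j x (take i (drop m ρ))) → Run m (suc i) P (ins (m ℕ.+ j) x ρ)
  Run-ins-after {m} {j} {i} {P} {x} {ρ} m≤ j≤i p =
    subst₂ P (cong sort (sym (take-ins-≥ m j x ρ m≤)))
             (sym (trans (cong (take (suc i)) (drop-ins-≥ m j x ρ m≤)) (take-ins-≤ x (drop m ρ) j≤i))) p

  Run-local : ∀ m i P l {x ρ} → m ℕ.+ i ℕ.≤ length ρ →
              Run m i P ρ → Run m i P (ins (m ℕ.+ i ℕ.+ l) x ρ)
  Run-local m i P l {x} {ρ} le p rewrite ℕ.+-assoc m i l =
    subst₂ P (cong sort (sym (take-ins-≥ m (i ℕ.+ l) x ρ m≤)))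
             (sym (trans (cong (take i) (drop-ins-≥ m (i ℕ.+ l) x ρ m≤)) (take-ins-≥ i l x (drop m ρ) (drop-≤ m ρ le)))) p
    where m≤ = ℕ.m+n≤o⇒m≤o m le

  Above-sample : ∀ {m b i ρ} → b ℕ.≤ m → ins⁻ b (Run (suc m) i Above) ρ
  Above-sample {m} {i = i} b≤m x x< = Run-ins-sample {P = Above} b≤m x< (above (take⁺ i (drop⁺ m x<)))

  -- The sampled best item becomes s₁ and beats all arrivals; the former best of the sample becomes
  -- s₂. What is left to ask is `Above` for a sample smaller by one.
  Above₂-sample : ∀ {m b j i ρ} → b ℕ.≤ m → j ℕ.≤ i → Run m j Above ρ → ins⁻ b (Run (suc m) i (Above₂ j)) ρ
  Above₂-sample {m} {b} {j} {i} {ρ} b≤m j≤i e x x< = Run-ins-sample {P = Above₂ j} b≤m x< (extend e)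
    where
    extend : ∀ {l} → Above l (take j (drop m ρ)) → Above₂ j (x ∷ l) (take i (drop m ρ))
    extend (above s<) = above₂ (take⁺ i (drop⁺ m x<))
      (subst (All _) (sym (trans (take-take j i (drop m ρ)) (cong (λ k → take k (drop m ρ)) (ℕ.m≤n⇒m⊓n≡m j≤i)))) s<)

  AtMostOne-sample : ∀ {m b i ρ} → suc m ℕ.≤ length ρ → b ℕ.≤ suc m → ins⁻ b (Run (suc (suc m)) i AtMostOne) ρ
  AtMostOne-sample {m} {b} {i} {ρ} m< b≤m x x< = Run-ins-sample {P = AtMostOne} b≤m x< (nonempty ρ m<)
    where
    nonempty : ∀ τ → suc m ℕ.≤ length τ → AtMostOne (x ∷ sort (take (suc m) τ)) (take i (drop (suc m) ρ))
    -- `atMostOne` needs a second threshold; the length of the sorted rest rules out `[]`.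
    nonempty (y ∷ τ) _ with insert y (sort (take m τ)) | ↭-length (sort-↭ (y ∷ take m τ))
    ... | s ∷ l | _ = atMostOne (select-≤1 (take⁺ i (drop⁺ (suc m) x<)))

  select-Above₂ : ∀ {j x s₁ s₂ r t} → x Fin.< s₂ → Above₂ j (s₁ ∷ s₂ ∷ r) t → length (select (s₂ ∷ s₁ ∷ []) (ins j x t)) ℕ.≤ 1
  select-Above₂ {j} x<s₂ (above₂ s₁< s₂<) = ℕ.≤-reflexive (cong length (select-ins j x<s₂ s₂< s₁<))

  AtMostOne-after : ∀ {m j i ρ} → m ℕ.≤ length ρ → j ℕ.≤ i → Run m i (Above₂ j) ρ → ins⁻ (m ℕ.+ j) (Run m (suc i) AtMostOne) ρ
  AtMostOne-after {m} {j} {i} {ρ} m≤ j≤i e x x< = Run-ins-after {P = AtMostOne} m≤ j≤i (extend (All-sort m x<) e)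
    where
    extend : ∀ {l t} → All (x Fin.<_) l → Above₂ j l t → AtMostOne l (ins j x t)
    extend (_ ∷ x<s₂ ∷ _) e@(above₂ _ _) = atMostOne (select-Above₂ x<s₂ e)

  accepted : ∀ m σ {s₁ s₂ r y} pre {post} → sort (take m σ) ≡ s₁ ∷ s₂ ∷ r → drop m σ ≡ pre ++ y ∷ post →
             y Fin.< s₁ → y Fin.< s₂ → length (select (s₂ ∷ s₁ ∷ []) pre) ℕ.≤ 1 → y ∈ optimistic 2 (suc m) σ
  accepted m σ pre eq₁ eq₂ y<s₁ y<s₂ le rewrite eq₁ | eq₂ = select-∋ pre (y<s₂ ∷ y<s₁ ∷ []) (s≤s le)

  -- For the case where the best item is sampled: it is s₁, which y does not beat, so y can only
  -- take the first slot.
  accepted-first : ∀ m σ {s₁ s₂ r y pre post} → sort (take m σ) ≡ s₁ ∷ s₂ ∷ r → drop m σ ≡ pre ++ y ∷ post →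
                   All (s₂ Fin.<_) pre → y Fin.< s₂ → y ∈ optimistic 2 (suc m) σ
  accepted-first m σ {y = y} {post = post} eq₁ eq₂ s₂< y<s₂ rewrite eq₁ | eq₂ =
    subst (y ∈_) (sym (trans (select-skip _ (y ∷ post) s₂<) (select-< _ post y<s₂))) (here refl)

  BestAccepted-after : ∀ {m i ρ} → m ℕ.≤ length ρ → Run m i AtMostOne ρ → ins⁻ (m ℕ.+ i) (BestAccepted m) ρ
  BestAccepted-after {m} {i} {ρ} m≤ e x x< =
    x , All-ins (m ℕ.+ i) ℕ.≤-refl (All.map ℕ.<⇒≤ x<) , accept refl (All-sort m x<) e
    where
    accept : ∀ {l} → sort (take m ρ) ≡ l → All (x Fin.<_) l → AtMostOne l (take i (drop m ρ)) →
             x ∈ optimistic 2 (suc m) (ins (m ℕ.+ i) x ρ)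
    accept eq (x<s₁ ∷ x<s₂ ∷ _) (atMostOne le) =
      accepted m (ins (m ℕ.+ i) x ρ) (take i (drop m ρ)) (trans (cong sort (take-ins-≥ m i x ρ m≤)) eq)
        (trans (drop-ins-≥ m i x ρ m≤) (ins-split i x (drop m ρ))) x<s₁ x<s₂ le

  SecondAccepted-intro : ∀ {m a b τ} x y → All (y Fin.<_) τ → All (x Fin.<_) (ins a y τ) →
           (x Fin.< y → y ∈ optimistic 2 (suc m) (ins b x (ins a y τ))) → SecondAccepted m (ins b x (ins a y τ))
  SecondAccepted-intro {a = a} {b} {τ} x y y< x< acc with All-resp-↭ (ins-↭ a y τ) x<
  ... | x<y ∷ _ = x , y , x<y ,
    All-ins b (inj₁ refl) (All-ins a (inj₂ ℕ.≤-refl) (All.map (inj₂ ∘ ℕ.<⇒≤) y<)) , acc x<y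

  SecondAccepted-sample : ∀ {m b i τ} → m ℕ.≤ length τ → b ℕ.≤ m → Run m i Above τ →
                          ins⁻ (m ℕ.+ i) (ins⁻ b (SecondAccepted (suc m))) τ
  SecondAccepted-sample {m} {b} {i} {τ} m≤ b≤m e y y< x x< = SecondAccepted-intro {suc m} {m ℕ.+ i} {b} x y y< x<
    (λ _ → accept refl (All-sort m y<) e)
    where
    t = drop m τ
    sample : sort (take (suc m) (ins b x (ins (m ℕ.+ i) y τ))) ≡ x ∷ sort (take m τ)
    sample = trans (cong sort (take-ins-≤ x (ins (m ℕ.+ i) y τ) b≤m))
      (trans (sort-ins b (take⁺ m x<)) (cong (λ ρ → x ∷ sort ρ) (take-ins-≥ m i y τ m≤)))
    rest : drop (suc m) (ins b x (ins (m ℕ.+ i) y τ)) ≡ take i t ++ y ∷ drop i t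
    rest = trans (drop-ins-≤ x (ins (m ℕ.+ i) y τ) b≤m) (trans (drop-ins-≥ m i y τ m≤) (ins-split i y t))
    accept : ∀ {r} → sort (take m τ) ≡ r → All (y Fin.<_) r → Above r (take i t) →
             y ∈ optimistic 2 (suc (suc m)) (ins b x (ins (m ℕ.+ i) y τ))
    accept eq (y<s ∷ _) (above s<) = accepted-first (suc m) (ins b x (ins (m ℕ.+ i) y τ)) (trans sample (cong (x ∷_) eq)) rest s< y<s

  SecondAccepted-before : ∀ {m i l τ} → m ℕ.+ i ℕ.≤ length τ → Run m i AtMostOne τ →
                          ins⁻ (m ℕ.+ i) (ins⁻ (m ℕ.+ (suc i ℕ.+ l)) (SecondAccepted m)) τ
  SecondAccepted-before {m} {i} {l} {τ} le e y y< x x< = SecondAccepted-intro {m} {m ℕ.+ i} {m ℕ.+ (suc i ℕ.+ l)} x y y< x<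
    (λ _ → accept refl (All-sort m y<) e)
    where
    σ = ins (m ℕ.+ (suc i ℕ.+ l)) x (ins (m ℕ.+ i) y τ)
    m≤ : m ℕ.≤ length τ
    m≤ = ℕ.m+n≤o⇒m≤o m le
    m≤′ : m ℕ.≤ length (ins (m ℕ.+ i) y τ)
    m≤′ = subst (m ℕ.≤_) (sym (length-ins (m ℕ.+ i) y τ)) (ℕ.m≤n⇒m≤1+n m≤)
    accept : ∀ {r} → sort (take m τ) ≡ r → All (y Fin.<_) r → AtMostOne r (take i (drop m τ)) → y ∈ optimistic 2 (suc m) σ
    accept eq (y<s₁ ∷ y<s₂ ∷ _) (atMostOne le₁) = accepted m σ (take i (drop m τ))
      (trans (cong sort (trans (take-ins-≥ m (suc i ℕ.+ l) x (ins (m ℕ.+ i) y τ) m≤′) (take-ins-≥ m i y τ m≤))) eq)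
      (trans (drop-ins-≥ m (suc i ℕ.+ l) x (ins (m ℕ.+ i) y τ) m≤′)
        (trans (cong (ins (suc i ℕ.+ l) x) (drop-ins-≥ m i y τ m≤)) (ins-ins-> i l x y (drop m τ) (drop-≤ m τ le))))
      y<s₁ y<s₂ le₁

  -- The best item x precedes y and beats both thresholds. A slot is still free for y if x is the
  -- only earlier acceptance, which `Above₂` guarantees.
  SecondAccepted-after : ∀ {m j i τ} → m ℕ.+ i ℕ.≤ length τ → j ℕ.≤ i → Run m i (Above₂ j) τ →
                         ins⁻ (m ℕ.+ i) (ins⁻ (m ℕ.+ j) (SecondAccepted m)) τ
  SecondAccepted-after {m} {j} {i} {τ} le j≤i e y y< x x< = SecondAccepted-intro {m} {m ℕ.+ i} {m ℕ.+ j} x y y< x<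
    (λ x<y → accept x<y refl (All-sort m y<) e)
    where
    σ = ins (m ℕ.+ j) x (ins (m ℕ.+ i) y τ)
    m≤ : m ℕ.≤ length τ
    m≤ = ℕ.m+n≤o⇒m≤o m le
    m≤′ : m ℕ.≤ length (ins (m ℕ.+ i) y τ)
    m≤′ = subst (m ℕ.≤_) (sym (length-ins (m ℕ.+ i) y τ)) (ℕ.m≤n⇒m≤1+n m≤)
    accept : ∀ {r} → x Fin.< y → sort (take m τ) ≡ r → All (y Fin.<_) r → Above₂ j r (take i (drop m τ)) → y ∈ optimistic 2 (suc m) σ
    accept x<y eq (y<s₁ ∷ y<s₂ ∷ _) e@(above₂ _ _) = accepted m σ (ins j x (take i (drop m τ)))
      (trans (cong sort (trans (take-ins-≥ m j x (ins (m ℕ.+ i) y τ) m≤′) (take-ins-≥ m i y τ m≤))) eq)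
      (trans (drop-ins-≥ m j x (ins (m ℕ.+ i) y τ) m≤′)
        (trans (cong (ins j x) (drop-ins-≥ m i y τ m≤)) (ins-ins-≤ x y (drop m τ) j≤i (drop-≤ m τ le))))
      y<s₁ y<s₂ (select-Above₂ (ℕ.<-trans x<y y<s₂) e)

-- Recursions for the probabilities

ι-inv-* : ∀ n x → ι (suc n) * (inv n * x) ≡ x
ι-inv-* n x = trans (sym (ℚ.*-assoc (ι (suc n)) (inv n) x)) (trans (cong (_* x) (ι-inv n)) (ℚ.*-identityˡ x))

module _ (μ : ℕ) where

  -- Sample size m = μ + 2; position m + i is indexed by i, and recip i = 1/(m − 1 + i).
  size-1 size : ℕ
  size-1 = suc μ
  size = suc size-1

  recip harmonic atMostOneπ : ℕ → ℚ
  recip i = inv (μ ℕ.+ i)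
  harmonic k = Σ< k recip
  atMostOneπ i = inv (size-1 ℕ.+ i) * (ι size * (1ℚ + ι size-1 * recip i * harmonic i))

  -- Two factors: m/(m + i) for the best of the first m + i items being sampled and, after its
  -- removal, (m - 1)/(m - 1 + j) for the best of the first m - 1 + j.
  above₂π : ℕ → ℕ → ℚ
  above₂π i j = inv (size-1 ℕ.+ i) * (ι size * (ι size-1 * recip j))

  -- Pr[second best accepted] when the best of n = m + k + 1 items is in the
  -- sample, respectively arrives at position m + j.
  sampleπ : ℕ → ℚ
  sampleπ k = inv (size-1 ℕ.+ k) * Σ< (suc k) (λ i → ι size-1 * recip i)

  afterπ : ℕ → ℕ → ℚ
  afterπ k j = inv (size-1 ℕ.+ k) * (Σ< j atMostOneπ + Σ< (k ℕ.∸ j) (λ l → above₂π (j ℕ.+ l) j))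

  inv-size-1+ : ∀ i → inv (size-1 ℕ.+ i) ≡ recip (suc i)
  inv-size-1+ i = cong inv (sym (ℕ.+-suc μ i))

  module _ {n : ℕ} where

    Likely-Above : ∀ i N → size-1 ℕ.+ i ℕ.≤ N → Likely {n} N (Run size-1 i Above) (ι size-1 * recip i)
    Likely-Above i N le = Likely-prefix (μ ℕ.+ i) (glue size-1 (λ _ → 1ℚ) (λ _ → 0ℚ))
      (λ l {x} {ρ} → Run-local size-1 i Above l {x} {ρ})
      (λ K _ → glue-elim size-1 (λ b → Likely K (ins⁻ b (Run size-1 i Above)))
        (λ b b<M → Likely-mono (λ _ _ _ → Above-sample (ℕ.≤-pred b<M)) (Likely-⊤ K))
        (λ l _ → Likely-0 K))
      total N le
      where
      total : ι (size-1 ℕ.+ i) * (ι size-1 * recip i) ≡ Σ< (size-1 ℕ.+ i) (glue size-1 (λ _ → 1ℚ) (λ _ → 0ℚ))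
      total = begin
        ι (size-1 ℕ.+ i) * (ι size-1 * recip i)               ≡⟨ cong (ι (size-1 ℕ.+ i) *_) (ℚ.*-comm (ι size-1) (recip i)) ⟩
        ι (size-1 ℕ.+ i) * (recip i * ι size-1)               ≡⟨ ι-inv-* (μ ℕ.+ i) (ι size-1) ⟩
        ι size-1                                              ≡⟨ solve 2 (λ a b → a := a :* con 1ℚ :+ b :* con 0ℚ) refl (ι size-1) (ι i) ⟩
        ι size-1 * 1ℚ + ι i * 0ℚ                              ≡⟨ cong₂ _+_ (Σ<-const size-1 1ℚ) (Σ<-const i 0ℚ) ⟨
        Σ< size-1 (λ _ → 1ℚ) + Σ< i (λ _ → 0ℚ)                ≡⟨ Σ<-glue size-1 i (λ _ → 1ℚ) (λ _ → 0ℚ) ⟨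
        Σ< (size-1 ℕ.+ i) (glue size-1 (λ _ → 1ℚ) (λ _ → 0ℚ)) ∎
        where
        open ≡-Reasoning
        open +-*-Solver

    Likely-Above₂ : ∀ {j i} N → j ℕ.≤ i → size ℕ.+ i ℕ.≤ N → Likely {n} N (Run size i (Above₂ j)) (above₂π i j)
    Likely-Above₂ {j} {i} N j≤i le = Likely-prefix (size-1 ℕ.+ i) (glue size (λ _ → ι size-1 * recip j) (λ _ → 0ℚ))
      (λ l {x} {ρ} → Run-local size i (Above₂ j) l {x} {ρ})
      (λ K M+i≤K → glue-elim size (λ b → Likely K (ins⁻ b (Run size i (Above₂ j))))
        (λ b b<m → Likely-mono (λ _ _ → Above₂-sample (ℕ.≤-pred b<m) j≤i)
                     (Likely-Above j K (ℕ.≤-trans (ℕ.+-monoʳ-≤ size-1 j≤i) M+i≤K)))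
        (λ l _ → Likely-0 K))
      total N le
      where
      total : ι (size ℕ.+ i) * above₂π i j ≡ Σ< (size ℕ.+ i) (glue size (λ _ → ι size-1 * recip j) (λ _ → 0ℚ))
      total = begin
        ι (size ℕ.+ i) * above₂π i j                                      ≡⟨ ι-inv-* (size-1 ℕ.+ i) (ι size * (ι size-1 * recip j)) ⟩
        ι size * (ι size-1 * recip j)                                     ≡⟨ solve 2 (λ a b → a := a :+ b :* con 0ℚ) refl (ι size * (ι size-1 * recip j)) (ι i) ⟩
        ι size * (ι size-1 * recip j) + ι i * 0ℚ                          ≡⟨ cong₂ _+_ (Σ<-const size (ι size-1 * recip j)) (Σ<-const i 0ℚ) ⟨
        Σ< size (λ _ → ι size-1 * recip j) + Σ< i (λ _ → 0ℚ)              ≡⟨ Σ<-glue size i (λ _ → ι size-1 * recip j) (λ _ → 0ℚ) ⟨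
        Σ< (size ℕ.+ i) (glue size (λ _ → ι size-1 * recip j) (λ _ → 0ℚ)) ∎
        where
        open ≡-Reasoning
        open +-*-Solver

    -- If the best of the first m + i items is sampled, the event is certain. If it sits at position
    -- m + j, `Above₂` is needed for the other i - 1 arrivals, whence `ℕ.pred i`; for i = 0 there is
    -- no such j, so the value at 0 does not matter.
    Likely-AtMostOne : ∀ i N → size ℕ.+ i ℕ.≤ N → Likely {n} N (Run size i AtMostOne) (atMostOneπ i)
    Likely-AtMostOne i N le = Likely-prefix (size-1 ℕ.+ i) (glue size (λ _ → 1ℚ) (above₂π (ℕ.pred i)))
      (λ l {x} {ρ} → Run-local size i AtMostOne l {x} {ρ})
      (λ K M+i≤K → glue-elim size (λ b → Likely K (ins⁻ b (Run size i AtMostOne)))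
        (λ b b<m → Likely-mono (λ ρ len _ → AtMostOne-sample (subst (size-1 ℕ.≤_) (sym len) (ℕ.m+n≤o⇒m≤o size-1 M+i≤K)) (ℕ.≤-pred b<m))
                     (Likely-⊤ K))
        (after i K M+i≤K))
      (trans (ι-inv-* (size-1 ℕ.+ i) _) (sym (total i))) N le
      where
      after : ∀ i K → size-1 ℕ.+ i ℕ.≤ K → ∀ j → j ℕ.< i → Likely K (ins⁻ (size ℕ.+ j) (Run size i AtMostOne)) (above₂π (ℕ.pred i) j)
      after (suc i) K le j (s≤s j≤i) = Likely-mono
        (λ ρ len → AtMostOne-after (subst (size ℕ.≤_) (sym len) (ℕ.m+n≤o⇒m≤o size m+i≤K)) j≤i)
        (Likely-Above₂ K j≤i m+i≤K)
        where
        m+i≤K : size ℕ.+ i ℕ.≤ K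
        m+i≤K = subst (ℕ._≤ K) (ℕ.+-suc size-1 i) le
      Σ<-g : ∀ i → Σ< i (above₂π (ℕ.pred i)) ≡ ι size * (ι size-1 * recip i * harmonic i)
      Σ<-g zero    = solve 3 (λ a b d → con 0ℚ := a :* (b :* d :* con 0ℚ)) refl (ι size) (ι size-1) (recip 0)
        where
        open +-*-Solver
      Σ<-g (suc i) = begin
        Σ< (suc i) (λ j → inv (size-1 ℕ.+ i) * (ι size * (ι size-1 * recip j)))
          ≡⟨ Σ<-cong (suc i) (λ j _ → solve 4 (λ x a b d → x :* (a :* (b :* d)) := x :* a :* b :* d) refl (inv (size-1 ℕ.+ i)) (ι size) (ι size-1) (recip j)) ⟩
        Σ< (suc i) (λ j → inv (size-1 ℕ.+ i) * ι size * ι size-1 * recip j)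
          ≡⟨ *-distribˡ-Σ< (suc i) (inv (size-1 ℕ.+ i) * ι size * ι size-1) recip ⟩
        inv (size-1 ℕ.+ i) * ι size * ι size-1 * harmonic (suc i)
          ≡⟨ cong (λ x → x * ι size * ι size-1 * harmonic (suc i)) (inv-size-1+ i) ⟩
        recip (suc i) * ι size * ι size-1 * harmonic (suc i)
          ≡⟨ solve 4 (λ x a b d → x :* a :* b :* d := a :* (b :* x :* d)) refl (recip (suc i)) (ι size) (ι size-1) (harmonic (suc i)) ⟩
        ι size * (ι size-1 * recip (suc i) * harmonic (suc i)) ∎
        where
        open ≡-Reasoning
        open +-*-Solver
      total : ∀ i → Σ< (size ℕ.+ i) (glue size (λ _ → 1ℚ) (above₂π (ℕ.pred i))) ≡ ι size * (1ℚ + ι size-1 * recip i * harmonic i)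
      total i = begin
        Σ< (size ℕ.+ i) (glue size (λ _ → 1ℚ) (above₂π (ℕ.pred i))) ≡⟨ Σ<-glue size i (λ _ → 1ℚ) (above₂π (ℕ.pred i)) ⟩
        Σ< size (λ _ → 1ℚ) + Σ< i (above₂π (ℕ.pred i))              ≡⟨ cong₂ _+_ (Σ<-const size 1ℚ) (Σ<-g i) ⟩
        ι size * 1ℚ + ι size * (ι size-1 * recip i * harmonic i)    ≡⟨ ℚ.*-distribˡ-+ (ι size) 1ℚ _ ⟨
        ι size * (1ℚ + ι size-1 * recip i * harmonic i)             ∎
        where
        open ≡-Reasoning

    Likely-BestAccepted : ∀ k → Likely {n} (size ℕ.+ k) (BestAccepted size) (inv (size-1 ℕ.+ k) * Σ< k atMostOneπ)
    Likely-BestAccepted k = Likely-step (glue size (λ _ → 0ℚ) atMostOneπ)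
      (glue-elim size (λ b → Likely (size-1 ℕ.+ k) (ins⁻ b (BestAccepted size)))
        (λ b _ → Likely-0 (size-1 ℕ.+ k))
        (λ i i<k → Likely-mono
          (λ ρ len → BestAccepted-after (subst (size ℕ.≤_) (sym len) (ℕ.m+n≤o⇒m≤o size (bound i<k))))
          (Likely-AtMostOne i (size-1 ℕ.+ k) (bound i<k))))
      (trans (ι-inv-* (size-1 ℕ.+ k) (Σ< k atMostOneπ)) (sym total))
      where
      bound : ∀ {i} → i ℕ.< k → size ℕ.+ i ℕ.≤ size-1 ℕ.+ k
      bound {i} i<k = subst (ℕ._≤ size-1 ℕ.+ k) (ℕ.+-suc size-1 i) (ℕ.+-monoʳ-≤ size-1 i<k)
      total : Σ< (size ℕ.+ k) (glue size (λ _ → 0ℚ) atMostOneπ) ≡ Σ< k atMostOneπ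
      total = trans (Σ<-glue size k (λ _ → 0ℚ) atMostOneπ)
        (trans (cong (_+ Σ< k atMostOneπ) (trans (Σ<-const size 0ℚ) (ℚ.*-zeroʳ (ι size)))) (ℚ.+-identityˡ (Σ< k atMostOneπ)))

    -- Without the sampled best item the sample has size m - 1 among m + k items, so y has k + 1
    -- possible positions after it.
    Likely-Second-sample : ∀ k {b} → b ℕ.< size → Likely {n} (size ℕ.+ k) (ins⁻ b (SecondAccepted size)) (sampleπ k)
    Likely-Second-sample k {b} (s≤s b≤M) = Likely-step (glue size-1 (λ _ → 0ℚ) (λ i → ι size-1 * recip i))
      (λ a a< → glue-elim size-1 {suc k} (λ a → Likely (size-1 ℕ.+ k) (ins⁻ a (ins⁻ b (SecondAccepted size))))
        (λ _ _ → Likely-0 (size-1 ℕ.+ k))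
        (λ i i≤k → Likely-mono
          (λ ρ len → SecondAccepted-sample (subst (size-1 ℕ.≤_) (sym len) (ℕ.m≤m+n size-1 k)) b≤M)
          (Likely-Above i (size-1 ℕ.+ k) (ℕ.+-monoʳ-≤ size-1 (ℕ.≤-pred i≤k))))
        a (subst (a ℕ.<_) (sym (ℕ.+-suc size-1 k)) a<))
      (trans (ι-inv-* (size-1 ℕ.+ k) _) (sym total))
      where
      f : ℕ → ℚ
      f i = ι size-1 * recip i
      total : Σ< (size ℕ.+ k) (glue size-1 (λ _ → 0ℚ) f) ≡ Σ< (suc k) f
      total = begin
        Σ< (size ℕ.+ k) (glue size-1 (λ _ → 0ℚ) f)       ≡⟨ cong (λ n → Σ< n (glue size-1 (λ _ → 0ℚ) f)) (ℕ.+-suc size-1 k) ⟨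
        Σ< (size-1 ℕ.+ suc k) (glue size-1 (λ _ → 0ℚ) f) ≡⟨ Σ<-glue size-1 (suc k) (λ _ → 0ℚ) f ⟩
        Σ< size-1 (λ _ → 0ℚ) + Σ< (suc k) f              ≡⟨ cong (_+ Σ< (suc k) f) (trans (Σ<-const size-1 0ℚ) (ℚ.*-zeroʳ (ι size-1))) ⟩
        0ℚ + Σ< (suc k) f                                ≡⟨ ℚ.+-identityˡ (Σ< (suc k) f) ⟩
        Σ< (suc k) f                                     ∎
        where
        open ≡-Reasoning

    Likely-Second-after : ∀ k {j} → j ℕ.≤ k → Likely {n} (size ℕ.+ k) (ins⁻ (size ℕ.+ j) (SecondAccepted size)) (afterπ k j)
    Likely-Second-after k {j} j≤k = Likely-step (glue size (λ _ → 0ℚ) w)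
      (glue-elim size (λ a → Likely (size-1 ℕ.+ k) (ins⁻ a E))
        (λ _ _ → Likely-0 (size-1 ℕ.+ k))
        -- A second split at j: for i < j the second best item stays ahead of the best one, for i ≥
        -- j it is pushed behind it.
        (λ i i<k → glue-elim j {k ℕ.∸ j} (λ i π → i ℕ.< k → Likely (size-1 ℕ.+ k) (ins⁻ (size ℕ.+ i) E) π)
          (λ i i<j i<k → Likely-mono (λ ρ len e → subst (λ j → ins⁻ (size ℕ.+ i) (ins⁻ (size ℕ.+ j) (SecondAccepted size)) ρ)
              (ℕ.m+[n∸m]≡n i<j) (SecondAccepted-before (subst (size ℕ.+ i ℕ.≤_) (sym len) (bound i<k)) e))
            (Likely-AtMostOne i (size-1 ℕ.+ k) (bound i<k)))
          (λ l _ j+l<k → Likely-mono (λ ρ len → SecondAccepted-after (subst (size ℕ.+ (j ℕ.+ l) ℕ.≤_) (sym len) (bound j+l<k)) (ℕ.m≤m+n j l))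
            (Likely-Above₂ (size-1 ℕ.+ k) (ℕ.m≤m+n j l) (bound j+l<k)))
          i (subst (i ℕ.<_) (sym (ℕ.m+[n∸m]≡n j≤k)) i<k) i<k))
      (trans (ι-inv-* (size-1 ℕ.+ k) _) (sym total))
      where
      E : Event {n}
      E = ins⁻ (size ℕ.+ j) (SecondAccepted size)
      w : ℕ → ℚ
      w = glue j atMostOneπ (λ l → above₂π (j ℕ.+ l) j)
      bound : ∀ {i} → i ℕ.< k → size ℕ.+ i ℕ.≤ size-1 ℕ.+ k
      bound {i} i<k = subst (ℕ._≤ size-1 ℕ.+ k) (ℕ.+-suc size-1 i) (ℕ.+-monoʳ-≤ size-1 i<k)
      total : Σ< (size ℕ.+ k) (glue size (λ _ → 0ℚ) w) ≡ Σ< j atMostOneπ + Σ< (k ℕ.∸ j) (λ l → above₂π (j ℕ.+ l) j)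
      total = begin
        Σ< (size ℕ.+ k) (glue size (λ _ → 0ℚ) w)                   ≡⟨ Σ<-glue size k (λ _ → 0ℚ) w ⟩
        Σ< size (λ _ → 0ℚ) + Σ< k w                                ≡⟨ cong (_+ Σ< k w) (trans (Σ<-const size 0ℚ) (ℚ.*-zeroʳ (ι size))) ⟩
        0ℚ + Σ< k w                                                ≡⟨ ℚ.+-identityˡ (Σ< k w) ⟩
        Σ< k w                                                     ≡⟨ cong (λ k → Σ< k w) (ℕ.m+[n∸m]≡n j≤k) ⟨
        Σ< (j ℕ.+ (k ℕ.∸ j)) w                                     ≡⟨ Σ<-glue j (k ℕ.∸ j) atMostOneπ _ ⟩
        Σ< j atMostOneπ + Σ< (k ℕ.∸ j) (λ l → above₂π (j ℕ.+ l) j) ∎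
        where
        open ≡-Reasoning

    Likely-SecondAccepted : ∀ k → Likely {n} (size ℕ.+ suc k) (SecondAccepted size)
                                    (inv (size-1 ℕ.+ suc k) * (ι size * sampleπ k + Σ< (suc k) (afterπ k)))
    Likely-SecondAccepted k = Likely-step (glue size (λ _ → sampleπ k) (afterπ k))
      (glue-elim size (λ b → Likely (size-1 ℕ.+ suc k) (ins⁻ b (SecondAccepted size)))
        (λ b b<m → shift (Likely-Second-sample k b<m))
        (λ j j≤k → shift (Likely-Second-after k (ℕ.≤-pred j≤k))))
      (trans (ι-inv-* (size-1 ℕ.+ suc k) _) (sym (trans (Σ<-glue size (suc k) (λ _ → sampleπ k) (afterπ k))
        (cong (_+ Σ< (suc k) (afterπ k)) (Σ<-const size (sampleπ k))))))
      where
      shift : ∀ {E π} → Likely (size ℕ.+ k) E π → Likely (size-1 ℕ.+ suc k) E π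
      shift {E} {π} = subst (λ N → Likely N E π) (sym (ℕ.+-suc size-1 k))

-- Closed forms of the recursions

-- The ring solver knows no hypotheses: a relation e ≡ 0ℚ enters as a multiple of e.
vanish : ∀ {x y e} c → x ≡ y + c * e → e ≡ 0ℚ → x ≡ y
vanish {y = y} c eq refl = trans eq (trans (cong (_+_ y) (ℚ.*-zeroʳ c)) (ℚ.+-identityʳ y))

-- The telescoping relation for reciprocals, in the form that `vanish` consumes.
inv-step : ∀ i → inv (suc i) + inv i * inv (suc i) - inv i ≡ 0ℚ
inv-step i = begin
  b + a * b - a                          ≡⟨ cong (λ x → b + a * b - x) (ℚ.*-identityʳ a) ⟨
  b + a * b - a * 1ℚ                     ≡⟨ cong (λ x → b + a * b - a * x) (ι-inv (suc i)) ⟨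
  b + a * b - a * (ι (suc (suc i)) * b)  ≡⟨ cong (λ x → b + a * b - a * (x * b)) (ι-suc (suc i)) ⟩
  b + a * b - a * ((1ℚ + ι (suc i)) * b) ≡⟨ solve 3 (λ a b d → b :+ a :* b :- a :* ((con 1ℚ :+ d) :* b) := b :- b :* (d :* a)) refl a b (ι (suc i)) ⟩
  b - b * (ι (suc i) * a)                ≡⟨ cong (λ x → b - b * x) (ι-inv i) ⟩
  b - b * 1ℚ                             ≡⟨ solve 1 (λ b → b :- b :* con 1ℚ := con 0ℚ) refl b ⟩
  0ℚ                                     ∎
  where
  open ≡-Reasoning
  open +-*-Solver
  a = inv i
  b = inv (suc i)

module _ (μ : ℕ) where

  private
    𝑀 = ι (size-1 μ)
    𝑚 = ι (size μ)
    a = recip μ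
    H = harmonic μ

  𝑀a₀≡1 : 𝑀 * a 0 ≡ 1ℚ
  𝑀a₀≡1 = trans (cong (λ i → 𝑀 * inv i) (ℕ.+-identityʳ μ)) (ι-inv μ)

  recip-step : ∀ i → a (suc i) + a i * a (suc i) - a i ≡ 0ℚ
  recip-step i = subst (λ j → inv j + a i * inv j - a i ≡ 0ℚ) (sym (ℕ.+-suc μ i)) (inv-step (μ ℕ.+ i))

  -- As a_i a_{i+1} = a_i - a_{i+1}, summation by parts gives Σ a_i a_{i+1} H_i = a_0 - a_k (1 +
  -- H_k) over i < k, and (m - 1) a_0 = 1.
  Σ<-atMostOneπ : ∀ k → Σ< k (atMostOneπ μ) ≡ 𝑚 * (H (suc k) - a 0 + 1ℚ - 𝑀 * a k * (1ℚ + H k))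
  Σ<-atMostOneπ zero = sym (begin
    𝑚 * (0ℚ + a 0 - a 0 + 1ℚ - 𝑀 * a 0 * (1ℚ + 0ℚ)) ≡⟨ cong (λ x → 𝑚 * (0ℚ + a 0 - a 0 + 1ℚ - x * (1ℚ + 0ℚ))) 𝑀a₀≡1 ⟩
    𝑚 * (0ℚ + a 0 - a 0 + 1ℚ - 1ℚ * (1ℚ + 0ℚ))      ≡⟨ solve 2 (λ m a → m :* (con 0ℚ :+ a :- a :+ con 1ℚ :- con 1ℚ :* (con 1ℚ :+ con 0ℚ)) := con 0ℚ) refl 𝑚 (a 0) ⟩
    0ℚ                                              ∎)
    where
    open ≡-Reasoning
    open +-*-Solver
  Σ<-atMostOneπ (suc k) = vanish (𝑚 * 𝑀 * (1ℚ + H k)) (begin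
    Σ< k (atMostOneπ μ) + inv (size-1 μ ℕ.+ k) * (𝑚 * (1ℚ + 𝑀 * a k * H k))
      ≡⟨ cong₂ _+_ (Σ<-atMostOneπ k) (cong (_* (𝑚 * (1ℚ + 𝑀 * a k * H k))) (inv-size-1+ μ k)) ⟩
    𝑚 * (H k + a k - a 0 + 1ℚ - 𝑀 * a k * (1ℚ + H k)) + a (suc k) * (𝑚 * (1ℚ + 𝑀 * a k * H k))
      ≡⟨ solve 6 (λ m M x a b z → m :* (x :+ a :- z :+ con 1ℚ :- M :* a :* (con 1ℚ :+ x)) :+ b :* (m :* (con 1ℚ :+ M :* a :* x))
           := m :* (x :+ a :+ b :- z :+ con 1ℚ :- M :* b :* (con 1ℚ :+ (x :+ a))) :+ m :* M :* (con 1ℚ :+ x) :* (b :+ a :* b :- a))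
           refl 𝑚 𝑀 (H k) (a k) (a (suc k)) (a 0) ⟩
    𝑚 * (H k + a k + a (suc k) - a 0 + 1ℚ - 𝑀 * a (suc k) * (1ℚ + (H k + a k))) + 𝑚 * 𝑀 * (1ℚ + H k) * (a (suc k) + a k * a (suc k) - a k) ∎)
    (recip-step k)
    where
    open ≡-Reasoning
    open +-*-Solver

  -- Sums the weights of `afterπ-closed` without their common factor. There X is the full sum
  -- `H (suc k)`; leaving it free lets the induction run over j alone.
  Σ<-Σ<-atMostOneπ : ∀ X j → Σ< j (λ i → Σ< i (atMostOneπ μ) + 𝑚 * 𝑀 * a i * (X - H (suc i))) ≡
                    𝑚 * (𝑀 + ι j) * (H (suc j) - a 0) - 𝑚 * 𝑀 * (H j + H j * H j - X * H j)
  Σ<-Σ<-atMostOneπ X zero = solve 5 (λ m M z y X → con 0ℚ := m :* (M :+ z) :* (con 0ℚ :+ y :- y) :- m :* M :* (con 0ℚ :+ con 0ℚ :* con 0ℚ :- X :* con 0ℚ))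
    refl 𝑚 𝑀 (ι 0) (a 0) X
    where
    open +-*-Solver
  Σ<-Σ<-atMostOneπ X (suc j) = vanish (- 𝑚) (begin
    Σ< j (λ i → Σ< i (atMostOneπ μ) + 𝑚 * 𝑀 * a i * (X - H (suc i))) + (Σ< j (atMostOneπ μ) + 𝑚 * 𝑀 * a j * (X - H (suc j)))
      ≡⟨ cong₂ (λ s t → s + (t + 𝑚 * 𝑀 * a j * (X - H (suc j)))) (Σ<-Σ<-atMostOneπ X j) (Σ<-atMostOneπ j) ⟩
    𝑚 * (𝑀 + ι j) * (H j + a j - a 0) - 𝑚 * 𝑀 * (H j + H j * H j - X * H j)
      + (𝑚 * (H j + a j - a 0 + 1ℚ - 𝑀 * a j * (1ℚ + H j)) + 𝑚 * 𝑀 * a j * (X - (H j + a j)))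
      ≡⟨ solve 8 (λ m M J x a b z X →
           m :* (M :+ J) :* (x :+ a :- z) :- m :* M :* (x :+ x :* x :- X :* x)
             :+ (m :* (x :+ a :- z :+ con 1ℚ :- M :* a :* (con 1ℚ :+ x)) :+ m :* M :* a :* (X :- (x :+ a)))
           := m :* (M :+ (con 1ℚ :+ J)) :* (x :+ a :+ b :- z) :- m :* M :* (x :+ a :+ (x :+ a) :* (x :+ a) :- X :* (x :+ a))
             :+ (:- m) :* ((M :+ (con 1ℚ :+ J)) :* b :- con 1ℚ))
           refl 𝑚 𝑀 (ι j) (H j) (a j) (a (suc j)) (a 0) X ⟩
    rhs (1ℚ + ι j) + (- 𝑚) * ((𝑀 + (1ℚ + ι j)) * a (suc j) - 1ℚ)
      ≡⟨ cong (λ J → rhs J + (- 𝑚) * ((𝑀 + J) * a (suc j) - 1ℚ)) (ι-suc j) ⟨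
    rhs (ι (suc j)) + (- 𝑚) * ((𝑀 + ι (suc j)) * a (suc j) - 1ℚ) ∎)
    (trans (cong (_- 1ℚ) (trans (cong (_* a (suc j)) (sym (ι-+ (size-1 μ) (suc j)))) (ι-inv (μ ℕ.+ suc j)))) (ℚ.+-inverseʳ 1ℚ))
    where
    open ≡-Reasoning
    open +-*-Solver
    rhs : ℚ → ℚ
    rhs J = 𝑚 * (𝑀 + J) * (H (suc (suc j)) - a 0) - 𝑚 * 𝑀 * (H (suc j) + H (suc j) * H (suc j) - X * H (suc j))

  afterπ-closed : ∀ k j → j ℕ.< suc k → afterπ μ k j ≡ inv (size-1 μ ℕ.+ k) * (Σ< j (atMostOneπ μ) + 𝑚 * 𝑀 * a j * (H (suc k) - H (suc j)))
  afterπ-closed k j (s≤s j≤k) = cong (λ x → inv (size-1 μ ℕ.+ k) * (Σ< j (atMostOneπ μ) + x)) (begin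
    Σ< (k ℕ.∸ j) (λ l → above₂π μ (j ℕ.+ l) j)
      ≡⟨ Σ<-cong (k ℕ.∸ j) (λ l _ → trans (cong (_* (𝑚 * (𝑀 * a j))) (inv-size-1+ μ (j ℕ.+ l)))
           (solve 4 (λ x m M a → x :* (m :* (M :* a)) := m :* M :* a :* x) refl (a (suc (j ℕ.+ l))) 𝑚 𝑀 (a j))) ⟩
    Σ< (k ℕ.∸ j) (λ l → 𝑚 * 𝑀 * a j * a (suc j ℕ.+ l))
      ≡⟨ *-distribˡ-Σ< (k ℕ.∸ j) (𝑚 * 𝑀 * a j) (λ l → a (suc j ℕ.+ l)) ⟩
    𝑚 * 𝑀 * a j * Σ< (k ℕ.∸ j) (λ l → a (suc j ℕ.+ l))
      ≡⟨ cong (𝑚 * 𝑀 * a j *_) (solve 2 (λ x y → y := x :+ y :- x) refl (H (suc j)) _) ⟩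
    𝑚 * 𝑀 * a j * (H (suc j) + Σ< (k ℕ.∸ j) (λ l → a (suc j ℕ.+ l)) - H (suc j))
      ≡⟨ cong (λ x → 𝑚 * 𝑀 * a j * (x - H (suc j))) (Σ<-+ (suc j) (k ℕ.∸ j) a) ⟨
    𝑚 * 𝑀 * a j * (H (suc j ℕ.+ (k ℕ.∸ j)) - H (suc j))
      ≡⟨ cong (λ x → 𝑚 * 𝑀 * a j * (H (suc x) - H (suc j))) (ℕ.m+[n∸m]≡n j≤k) ⟩
    𝑚 * 𝑀 * a j * (H (suc k) - H (suc j)) ∎)
    where
    open ≡-Reasoning
    open +-*-Solver

  -- The second best item is accepted exactly as often as the classical
  -- single-choice rule with the same sample hires the best one.
  SecondAccepted-closed : ∀ k → 𝑚 * sampleπ μ k + Σ< (suc k) (afterπ μ k) ≡ 𝑚 * (H (suc (suc k)) - a 0)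
  SecondAccepted-closed k = begin
    𝑚 * sampleπ μ k + Σ< (suc k) (afterπ μ k)
      ≡⟨ cong₂ (λ s t → 𝑚 * (e * s) + t) (*-distribˡ-Σ< (suc k) 𝑀 a)
           (trans (Σ<-cong (suc k) (afterπ-closed k)) (trans (*-distribˡ-Σ< (suc k) e _) (cong (e *_) (Σ<-Σ<-atMostOneπ X (suc k))))) ⟩
    𝑚 * (e * (𝑀 * X)) + e * (𝑚 * (𝑀 + ι (suc k)) * (H (suc (suc k)) - a 0) - 𝑚 * 𝑀 * (X + X * X - X * X))
      -- At H = X the squares cancel, and the remaining linear term cancels the contribution of a
      -- sampled best item.
      ≡⟨ solve 6 (λ m M e X J y → m :* (e :* (M :* X)) :+ e :* (m :* (M :+ J) :* y :- m :* M :* (X :+ X :* X :- X :* X))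
           := (M :+ J) :* e :* (m :* y)) refl 𝑚 𝑀 e X (ι (suc k)) (H (suc (suc k)) - a 0) ⟩
    (𝑀 + ι (suc k)) * e * (𝑚 * (H (suc (suc k)) - a 0))
      ≡⟨ cong (λ x → x * e * (𝑚 * (H (suc (suc k)) - a 0))) (trans (sym (ι-+ (size-1 μ) (suc k))) (cong ι (ℕ.+-suc (size-1 μ) k))) ⟩
    ι (suc (size-1 μ ℕ.+ k)) * e * (𝑚 * (H (suc (suc k)) - a 0))
      ≡⟨ trans (cong (_* (𝑚 * (H (suc (suc k)) - a 0))) (ι-inv (size-1 μ ℕ.+ k))) (ℚ.*-identityˡ _) ⟩
    𝑚 * (H (suc (suc k)) - a 0) ∎
    where
    open ≡-Reasoning
    open +-*-Solver
    e = inv (size-1 μ ℕ.+ k)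
    X = H (suc k)

-- Order, and a lower bound for the harmonic sum uniform in n

ι≥0 : ∀ n → 0ℚ ≤ ι n
ι≥0 n = ℚ.nonNegative⁻¹ (ι n) {{ι-nonNeg n}}

inv≥0 : ∀ n → 0ℚ ≤ inv n
inv≥0 n = ℚ.nonNegative⁻¹ (inv n) {{inv-nonNeg n}}

*-monoˡ : ∀ {x y z} → 0ℚ ≤ z → x ≤ y → z * x ≤ z * y
*-monoˡ {z = z} 0≤z = ℚ.*-monoˡ-≤-nonNeg z {{ℚ.nonNegative 0≤z}}

*-mono : ∀ {x y z w} → 0ℚ ≤ x → 0ℚ ≤ w → x ≤ y → z ≤ w → x * z ≤ y * w
*-mono {x} {y} {z} {w} 0≤x 0≤w x≤y z≤w =
  ℚ.≤-trans (*-monoˡ 0≤x z≤w) (ℚ.*-monoʳ-≤-nonNeg w {{ℚ.nonNegative 0≤w}} x≤y)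

*≥0 : ∀ {x y} → 0ℚ ≤ x → 0ℚ ≤ y → 0ℚ ≤ x * y
*≥0 {x} {y} 0≤x 0≤y = subst (_≤ x * y) (ℚ.*-zeroʳ x) (*-monoˡ 0≤x 0≤y)

inv-antitone : ∀ {i j} → i ℕ.≤ j → inv j ≤ inv i
inv-antitone {i} {j} i≤j = begin
  inv j                       ≡⟨ ι-inv-* i (inv j) ⟨
  ι (suc i) * (inv i * inv j) ≤⟨ ℚ.*-monoʳ-≤-nonNeg (inv i * inv j) {{ℚ.nonNegative (*≥0 (inv≥0 i) (inv≥0 j))}} (ι-mono (s≤s i≤j)) ⟩
  ι (suc j) * (inv i * inv j) ≡⟨ cong (ι (suc j) *_) (ℚ.*-comm (inv i) (inv j)) ⟩
  ι (suc j) * (inv j * inv i) ≡⟨ ι-inv-* j (inv i) ⟩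
  inv i                       ∎
  where
  open ℚ.≤-Reasoning

-- `p ℕ.+ y ℕ.* suc p` is by computation the predecessor of `suc y ℕ.* suc p`, so no subtraction
-- appears.
inv-* : ∀ p y → ι (suc p) * inv (p ℕ.+ y ℕ.* suc p) ≡ inv y
inv-* p y = begin
  ι (suc p) * e                         ≡⟨ ι-inv-* y _ ⟨
  ι (suc y) * (inv y * (ι (suc p) * e)) ≡⟨ solve 4 (λ a b c d → a :* (b :* (c :* d)) := b :* (a :* c :* d)) refl (ι (suc y)) (inv y) (ι (suc p)) e ⟩
  inv y * (ι (suc y) * ι (suc p) * e)   ≡⟨ cong (λ x → inv y * (x * e)) (ι-* (suc y) (suc p)) ⟨
  inv y * (ι (suc y ℕ.* suc p) * e)     ≡⟨ cong (inv y *_) (ι-inv (p ℕ.+ y ℕ.* suc p)) ⟩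
  inv y * 1ℚ                            ≡⟨ ℚ.*-identityʳ (inv y) ⟩
  inv y                                 ∎
  where
  open ≡-Reasoning
  open +-*-Solver
  e = inv (p ℕ.+ y ℕ.* suc p)

-- Each block of suc p consecutive terms is at least suc p times its last one.
harmonic-blocks : ∀ a p d → Σ< d (λ x → inv (suc a ℕ.+ x)) ≤ Σ< (d ℕ.* suc p) (λ i → inv (p ℕ.+ a ℕ.* suc p ℕ.+ i))
harmonic-blocks a p zero    = ℚ.≤-refl
harmonic-blocks a p (suc d) = begin
  Σ< d (λ x → inv (suc a ℕ.+ x)) + inv (suc a ℕ.+ d)
    ≤⟨ ℚ.+-mono-≤ (harmonic-blocks a p d) block ⟩
  Σ< (d ℕ.* suc p) w + Σ< (suc p) (λ l → w (d ℕ.* suc p ℕ.+ l))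
    ≡⟨ Σ<-+ (d ℕ.* suc p) (suc p) w ⟨
  Σ< (d ℕ.* suc p ℕ.+ suc p) w
    ≡⟨ cong (λ n → Σ< n w) (ℕ.+-comm (d ℕ.* suc p) (suc p)) ⟩
  Σ< (suc d ℕ.* suc p) w ∎
  where
  open ℚ.≤-Reasoning
  w : ℕ → ℚ
  w i = inv (p ℕ.+ a ℕ.* suc p ℕ.+ i)
  last : ∀ l → l ℕ.< suc p → p ℕ.+ a ℕ.* suc p ℕ.+ (d ℕ.* suc p ℕ.+ l) ℕ.≤ p ℕ.+ (suc a ℕ.+ d) ℕ.* suc p
  last l l< = subst₂ ℕ._≤_ (sym (ℕ.+-assoc p _ _)) refl (ℕ.+-monoʳ-≤ p
    (subst₂ ℕ._≤_ (ℕ.+-assoc (a ℕ.* suc p) (d ℕ.* suc p) l)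
      (trans (cong (ℕ._+ suc p) (sym (ℕ.*-distribʳ-+ (suc p) a d))) (ℕ.+-comm _ (suc p)))
      (ℕ.+-monoʳ-≤ (a ℕ.* suc p ℕ.+ d ℕ.* suc p) (ℕ.<⇒≤ l<))))
  block : inv (suc a ℕ.+ d) ≤ Σ< (suc p) (λ l → w (d ℕ.* suc p ℕ.+ l))
  block = begin
    inv (suc a ℕ.+ d)                                      ≡⟨ inv-* p (suc a ℕ.+ d) ⟨
    ι (suc p) * inv (p ℕ.+ (suc a ℕ.+ d) ℕ.* suc p)        ≡⟨ Σ<-const (suc p) _ ⟨
    Σ< (suc p) (λ _ → inv (p ℕ.+ (suc a ℕ.+ d) ℕ.* suc p)) ≤⟨ Σ<-mono-≤ (suc p) (λ l l< → inv-antitone (last l l<)) ⟩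
    Σ< (suc p) (λ l → w (d ℕ.* suc p ℕ.+ l))               ∎

-- A sum of thousands of fractions has an enormous denominator. Rounding each term down to a
-- multiple of 1/S leaves a computation in ℕ.
floorSum : ℕ → ℕ → ℕ → ℕ
floorSum S a zero    = 0
floorSum S a (suc d) = floorSum S a d ℕ.+ S ℕ./ suc (suc a ℕ.+ d)

floorSum-≤ : ∀ S a d → ι (floorSum (suc S) a d) ≤ ι (suc S) * Σ< d (λ x → inv (suc a ℕ.+ x))
floorSum-≤ S a zero    = ℚ.≤-reflexive (trans ι-zero (sym (ℚ.*-zeroʳ (ι (suc S)))))
floorSum-≤ S a (suc d) = begin
  ι (floorSum (suc S) a d ℕ.+ f)    ≡⟨ ι-+ (floorSum (suc S) a d) f ⟩
  ι (floorSum (suc S) a d) + ι f    ≤⟨ ℚ.+-mono-≤ (floorSum-≤ S a d) term ⟩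
  ι (suc S) * s + ι (suc S) * inv y ≡⟨ ℚ.*-distribˡ-+ (ι (suc S)) s (inv y) ⟨
  ι (suc S) * (s + inv y)           ∎
  where
  open ℚ.≤-Reasoning
  y = suc a ℕ.+ d
  f = suc S ℕ./ suc y
  s = Σ< d (λ x → inv (suc a ℕ.+ x))
  term : ι f ≤ ι (suc S) * inv y
  term = begin
    ι f                       ≡⟨ ι-inv-* y (ι f) ⟨
    ι (suc y) * (inv y * ι f) ≡⟨ solve 3 (λ a b c → a :* (b :* c) := c :* a :* b) refl (ι (suc y)) (inv y) (ι f) ⟩
    ι f * ι (suc y) * inv y   ≡⟨ cong (_* inv y) (ι-* f (suc y)) ⟨
    ι (f ℕ.* suc y) * inv y   ≤⟨ ℚ.*-monoʳ-≤-nonNeg (inv y) {{inv-nonNeg y}} (ι-mono (m/n*n≤m (suc S) (suc y))) ⟩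
    ι (suc S) * inv y         ∎
    where
    open +-*-Solver

-- The scale is (p + 1)², the square of the denominator of the target N/(p + 1), so each term loses
-- less than 1/(p + 1)².
floorSum⇒harmonic : ∀ p N a d → suc p ℕ.* N ℕ.≤ floorSum (suc (p ℕ.+ p ℕ.* suc p)) a d →
                    inv p * ι N ≤ Σ< d (λ x → inv (suc a ℕ.+ x))
floorSum⇒harmonic p N a d le = begin
  inv p * ι N               ≡⟨ cong (_* ι N) (inv-* p p) ⟨
  ι (suc p) * inv S * ι N   ≡⟨ solve 3 (λ a b c → a :* b :* c := b :* (a :* c)) refl (ι (suc p)) (inv S) (ι N) ⟩
  inv S * (ι (suc p) * ι N) ≡⟨ cong (inv S *_) (ι-* (suc p) N) ⟨
  inv S * ι (suc p ℕ.* N)   ≤⟨ *-monoˡ (inv≥0 S) (ℚ.≤-trans (ι-mono le) (floorSum-≤ S a d)) ⟩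
  inv S * (ι (suc S) * s)   ≡⟨ solve 3 (λ a b c → a :* (b :* c) := b :* (a :* c)) refl (inv S) (ι (suc S)) s ⟩
  ι (suc S) * (inv S * s)   ≡⟨ ι-inv-* S s ⟩
  s                         ∎
  where
  open ℚ.≤-Reasoning
  open +-*-Solver
  S = p ℕ.+ p ℕ.* suc p
  s = Σ< d (λ x → inv (suc a ℕ.+ x))

-- H₀ is a lower bound of H = 1/m + … + 1/(n−1), δ₀ an upper bound of 1/(m−1).
H₀ α₀ δ₀ τ : ℚ
H₀ = + 10437 ℚ./ 10000
α₀ = + 3521 ℚ./ 10000
δ₀ = + 1 ℚ./ 3520
τ  = + 4168 ℚ./ 10000

-- 1/3522 + … + 1/10000 ≥ 1.0437 with every term rounded down to a multiple of 10⁻⁸.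
floorSum-value : 10000 ℕ.* 10437 ℕ.≤ floorSum 100000000 3520 6479
floorSum-value = ℕ.≤ᵇ⇒≤ (10000 ℕ.* 10437) (floorSum 100000000 3520 6479) tt

H₀≤harmonic : ∀ p → H₀ ≤ Σ< (6479 ℕ.* suc p) (λ i → inv (p ℕ.+ 3520 ℕ.* suc p ℕ.+ i))
H₀≤harmonic p = ℚ.≤-trans (ℚ.≤-reflexive (/-ι 10437 9999))
  (ℚ.≤-trans (floorSum⇒harmonic 9999 10437 3520 6479 floorSum-value) (harmonic-blocks 3520 p 6479))

τ≤best : τ ≤ α₀ * (H₀ + 1ℚ - α₀ * (1ℚ + H₀ + δ₀))
τ≤best = from-yes (τ ℚ.≤? α₀ * (H₀ + 1ℚ - α₀ * (1ℚ + H₀ + δ₀)))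

2τ≤best+second : τ + τ ≤ α₀ * (H₀ + 1ℚ - α₀ * (1ℚ + H₀ + δ₀)) + α₀ * H₀
2τ≤best+second = from-yes (τ + τ ℚ.≤? α₀ * (H₀ + 1ℚ - α₀ * (1ℚ + H₀ + δ₀)) + α₀ * H₀)

0≤1 : 0ℚ ≤ 1ℚ
0≤1 = from-yes (0ℚ ℚ.≤? 1ℚ)

sub-≥0 : ∀ {x y} → x ≤ y → 0ℚ ≤ y - x
sub-≥0 {x} {y} x≤y = subst (_≤ y - x) (ℚ.+-inverseʳ x) (ℚ.+-monoˡ-≤ (- x) x≤y)

≤-from-difference : ∀ {x y} z → y ≡ x + z → 0ℚ ≤ z → x ≤ y
≤-from-difference {x} z refl 0≤z = subst (_≤ x + z) (ℚ.+-identityʳ x) (ℚ.+-monoʳ-≤ x 0≤z)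

-- Estimates for sample size 0.3521 n

module _ (μ k p : ℕ) (m≡ : size μ ≡ suc (p ℕ.+ 3520 ℕ.* suc p)) (k≡ : suc k ≡ 6479 ℕ.* suc p)
         (ratio : 10000 ℕ.* size μ ≡ 3521 ℕ.* (size μ ℕ.+ suc k)) where

  private
    K = suc k
    𝑀 = ι (size-1 μ)
    𝑚 = ι (size μ)
    a = recip μ
    H = harmonic μ
    e = inv (size-1 μ ℕ.+ K)
    α = e * 𝑚
    -- `H` starts at 1/(m - 1); removing that term leaves 1/m + ... + 1/(n - 1).
    Hₙ = H (suc K) - a 0

  π₁ π₂ : ℚ
  π₁ = e * Σ< K (atMostOneπ μ)
  π₂ = e * (𝑚 * sampleπ μ k + Σ< K (afterπ μ k))

  α≡α₀ : α ≡ α₀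
  α≡α₀ = begin
    e * 𝑚                                      ≡⟨ ι-inv-* 9999 (e * 𝑚) ⟨
    ι 10000 * (inv 9999 * (e * 𝑚))             ≡⟨ solve 4 (λ x y e m → x :* (y :* (e :* m)) := y :* (x :* m :* e)) refl (ι 10000) (inv 9999) e 𝑚 ⟩
    inv 9999 * (ι 10000 * 𝑚 * e)               ≡⟨ cong (λ x → inv 9999 * (x * e)) (trans (sym (ι-* 10000 (size μ))) (trans (cong ι ratio) (ι-* 3521 (size μ ℕ.+ K)))) ⟩
    inv 9999 * (ι 3521 * ι (size μ ℕ.+ K) * e) ≡⟨ cong (inv 9999 *_) (trans (ℚ.*-assoc (ι 3521) _ e) (trans (cong (ι 3521 *_) (ι-inv (size-1 μ ℕ.+ K))) (ℚ.*-identityʳ (ι 3521)))) ⟩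
    inv 9999 * ι 3521                          ≡⟨ /-ι 3521 9999 ⟨
    α₀                                         ∎
    where
    open ≡-Reasoning
    open +-*-Solver

  α≥0 : 0ℚ ≤ α
  α≥0 = *≥0 (inv≥0 (size-1 μ ℕ.+ K)) (ι≥0 (size μ))

  -- (m − 1)/(n − 1) ≤ m/n
  𝑀a≤α : 𝑀 * a K ≤ α
  𝑀a≤α = ≤-from-difference (e * (ι K * a K))
    (vanish 𝑀 (vanish e (begin
      e * 𝑚
        ≡⟨ cong (e *_) (ι-suc (size-1 μ)) ⟩
      e * (1ℚ + 𝑀)
        ≡⟨ solve 4 (λ e M a K → e :* (con 1ℚ :+ M) := M :* a :+ e :* (K :* a) :+ M :* (e :+ a :* e :- a) :+ e :* (con 1ℚ :- (M :+ K) :* a))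
             refl e 𝑀 (a K) (ι K) ⟩
      𝑀 * a K + e * (ι K * a K) + 𝑀 * (e + a K * e - a K) + e * (1ℚ - (𝑀 + ι K) * a K) ∎)
      (trans (cong (λ x → 1ℚ - x) (trans (cong (_* a K) (sym (ι-+ (size-1 μ) K))) (ι-inv (μ ℕ.+ K)))) (ℚ.+-inverseʳ 1ℚ)))
      (subst (λ e → e + a K * e - a K ≡ 0ℚ) (sym (inv-size-1+ μ K)) (recip-step μ K)))
    (*≥0 (inv≥0 (size-1 μ ℕ.+ K)) (*≥0 (ι≥0 K) (inv≥0 (μ ℕ.+ K))))
    where
    open ≡-Reasoning
    open +-*-Solver

  H₀≤Hₙ : H₀ ≤ Hₙ
  H₀≤Hₙ = begin
    H₀                                                           ≤⟨ H₀≤harmonic p ⟩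
    Σ< (6479 ℕ.* suc p) (λ i → inv (p ℕ.+ 3520 ℕ.* suc p ℕ.+ i)) ≡⟨ cong₂ (λ K′ M′ → Σ< K′ (λ i → inv (M′ ℕ.+ i))) (sym k≡) (sym (ℕ.suc-injective m≡)) ⟩
    Σ< K (λ i → inv (size-1 μ ℕ.+ i))                            ≡⟨ Σ<-cong K (λ i _ → inv-size-1+ μ i) ⟩
    Σ< K (a ∘ suc)                                               ≡⟨ solve 2 (λ x y → y := x :+ y :- x) refl (a 0) (Σ< K (a ∘ suc)) ⟩
    a 0 + Σ< K (a ∘ suc) - a 0                                   ≡⟨ cong (_- a 0) (Σ<-suc K a) ⟨
    Hₙ                                                           ∎
    where
    open ℚ.≤-Reasoning
    open +-*-Solver

  a₀≤δ₀ : a 0 ≤ δ₀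
  a₀≤δ₀ = ℚ.≤-trans (inv-antitone 3519≤μ)
    (ℚ.≤-reflexive (sym (trans (/-ι 1 3519) (trans (cong (inv 3519 *_) ι-one) (ℚ.*-identityʳ (inv 3519))))))
    where
    3519≤μ : 3519 ℕ.≤ μ ℕ.+ 0
    3519≤μ = subst (3519 ℕ.≤_) (sym (ℕ.+-identityʳ μ)) (ℕ.≤-pred (subst (3520 ℕ.≤_) (sym (ℕ.suc-injective m≡))
      (ℕ.≤-trans (ℕ.m≤m*n 3520 (suc p)) (ℕ.m≤n+m (3520 ℕ.* suc p) p))))

  π₂-closed : π₂ ≡ α * Hₙ
  π₂-closed = trans (cong (e *_) (SecondAccepted-closed μ k)) (sym (ℚ.*-assoc e 𝑚 Hₙ))

  π₂-bound : α₀ * H₀ ≤ π₂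
  π₂-bound = subst₂ (λ x y → x * H₀ ≤ y) α≡α₀ (sym π₂-closed) (*-monoˡ α≥0 H₀≤Hₙ)

  -- The closed form loses in two steps: `𝑀 * a K` and `H K` are raised to α and `Hₙ + a 0`; the
  -- result grows with `Hₙ`, with slope proportional to 1 - α₀, and falls with `a 0`, so H₀ and δ₀
  -- may replace them.
  π₁-bound : α₀ * (H₀ + 1ℚ - α₀ * (1ℚ + H₀ + δ₀)) ≤ π₁
  π₁-bound = begin
    α₀ * (H₀ + 1ℚ - α₀ * (1ℚ + H₀ + δ₀))
      ≤⟨ *-monoˡ α₀≥0 inner ⟩
    α₀ * (Hₙ + 1ℚ - α₀ * (1ℚ + Hₙ + a 0))
      ≡⟨ cong (λ x → x * (Hₙ + 1ℚ - x * (1ℚ + Hₙ + a 0))) α≡α₀ ⟨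
    α * (Hₙ + 1ℚ - α * (1ℚ + Hₙ + a 0))
      ≤⟨ *-monoˡ α≥0 (ℚ.+-monoʳ-≤ (Hₙ + 1ℚ) (ℚ.neg-antimono-≤
           (*-mono (*≥0 (ι≥0 (size-1 μ)) (inv≥0 (μ ℕ.+ K))) 1+H+a≥0 𝑀a≤α
             (≤-from-difference (a K) (solve 3 (λ x y z → con 1ℚ :+ (x :+ y :- z) :+ z := con 1ℚ :+ x :+ y) refl (H K) (a K) (a 0)) (inv≥0 (μ ℕ.+ K)))))) ⟩
    α * (Hₙ + 1ℚ - 𝑀 * a K * (1ℚ + H K))
      ≡⟨ trans (ℚ.*-assoc e 𝑚 _) (cong (e *_) (sym (Σ<-atMostOneπ μ K))) ⟩
    π₁ ∎
    where
    open ℚ.≤-Reasoning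
    open +-*-Solver
    α₀≥0 : 0ℚ ≤ α₀
    α₀≥0 = from-yes (0ℚ ℚ.≤? α₀)
    Hₙ≥0 : 0ℚ ≤ Hₙ
    Hₙ≥0 = ℚ.≤-trans (from-yes (0ℚ ℚ.≤? H₀)) H₀≤Hₙ
    1+H+a≥0 : 0ℚ ≤ 1ℚ + Hₙ + a 0
    1+H+a≥0 = ℚ.+-mono-≤ (ℚ.+-mono-≤ 0≤1 Hₙ≥0) (inv≥0 (μ ℕ.+ 0))
    inner : H₀ + 1ℚ - α₀ * (1ℚ + H₀ + δ₀) ≤ Hₙ + 1ℚ - α₀ * (1ℚ + Hₙ + a 0)
    inner = ≤-from-difference ((1ℚ - α₀) * (Hₙ - H₀) + α₀ * (δ₀ - a 0))
      (solve 5 (λ α x l d a → x :+ con 1ℚ :- α :* (con 1ℚ :+ x :+ a) :=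
          l :+ con 1ℚ :- α :* (con 1ℚ :+ l :+ d) :+ ((con 1ℚ :- α) :* (x :- l) :+ α :* (d :- a))) refl α₀ Hₙ H₀ δ₀ (a 0))
      (ℚ.+-mono-≤ (*≥0 (from-yes (0ℚ ℚ.≤? 1ℚ - α₀)) (sub-≥0 H₀≤Hₙ)) (*≥0 α₀≥0 (sub-≥0 a₀≤δ₀)))

-- From acceptance probabilities to expected values

-- Kronecker's delta as a value function: `ALG (δ x)` counts the acceptances of x and is the
-- majorant fed to `Likely`.
δ : ∀ {n} → Fin n → Fin n → ℚ
δ zero    zero    = 1ℚ
δ zero    (suc _) = 0ℚ
δ (suc _) zero    = 0ℚ
δ (suc i) (suc j) = δ i j

δ≥0 : ∀ {n} (i j : Fin n) → 0ℚ ≤ δ i j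
δ≥0 zero    zero    = 0≤1
δ≥0 zero    (suc _) = ℚ.≤-refl
δ≥0 (suc _) zero    = ℚ.≤-refl
δ≥0 (suc i) (suc j) = δ≥0 i j

δ-refl : ∀ {n} (i : Fin n) → δ i i ≡ 1ℚ
δ-refl zero    = refl
δ-refl (suc i) = δ-refl i

sum-≥0 : ∀ {n} (f : Fin n → ℚ) → (∀ y → 0ℚ ≤ f y) → ∀ l → 0ℚ ≤ sumℚ (map f l)
sum-≥0 f f≥0 []      = ℚ.≤-refl
sum-≥0 f f≥0 (y ∷ l) = ℚ.+-mono-≤ (f≥0 y) (sum-≥0 f f≥0 l)

∈⇒1≤sum : ∀ {n} {x : Fin n} {l} → x ∈ l → 1ℚ ≤ sumℚ (map (δ x) l)
∈⇒1≤sum {x = x} {l = _ ∷ l} (here refl) = ℚ.+-mono-≤ (ℚ.≤-reflexive (sym (δ-refl x))) (sum-≥0 (δ x) (δ≥0 x) l)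
∈⇒1≤sum {x = x} {l = y ∷ _} (there x∈)  = ℚ.+-mono-≤ (δ≥0 x y) (∈⇒1≤sum x∈)

module _ {n : ℕ} (v : Fin (suc (suc n)) → ℚ) (v>0 : Positive v) where

  private
    0F 1F : Fin (suc (suc n))
    0F = zero
    1F = suc zero

  -- Positivity allows the gain from all items but the two best to be dropped.
  value-≥ : ∀ y → v 0F * δ 0F y + v 1F * δ 1F y ≤ v y
  value-≥ zero          = ℚ.≤-reflexive (solve 2 (λ a b → a :* con 1ℚ :+ b :* con 0ℚ := a) refl (v 0F) (v 1F))
    where
    open +-*-Solver
  value-≥ (suc zero)    = ℚ.≤-reflexive (solve 2 (λ a b → a :* con 0ℚ :+ b :* con 1ℚ := b) refl (v 0F) (v 1F))
    where
    open +-*-Solver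
  value-≥ (suc (suc y)) = ℚ.≤-trans (ℚ.≤-reflexive (solve 2 (λ a b → a :* con 0ℚ :+ b :* con 0ℚ := con 0ℚ) refl (v 0F) (v 1F)))
                                    (ℚ.<⇒≤ (v>0 (suc (suc y))))
    where
    open +-*-Solver

  sum-value-≥ : ∀ l → v 0F * sumℚ (map (δ 0F) l) + v 1F * sumℚ (map (δ 1F) l) ≤ sumℚ (map v l)
  sum-value-≥ []      = ℚ.≤-reflexive (solve 2 (λ a b → a :* con 0ℚ :+ b :* con 0ℚ := con 0ℚ) refl (v 0F) (v 1F))
    where
    open +-*-Solver
  sum-value-≥ (y ∷ l) = ℚ.≤-trans
    (ℚ.≤-reflexive (solve 6 (λ a b x y s t → a :* (x :+ s) :+ b :* (y :+ t) := a :* x :+ b :* y :+ (a :* s :+ b :* t)) refl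
      (v 0F) (v 1F) (δ 0F y) (δ 1F y) (sumℚ (map (δ 0F) l)) (sumℚ (map (δ 1F) l))))
    (ℚ.+-mono-≤ (value-≥ y) (sum-value-≥ l))
    where
    open +-*-Solver

module _ {n : ℕ} (m : ℕ) where

  private
    N : ℕ
    N = suc (suc n)
    0F 1F : Fin N
    0F = zero
    1F = suc zero

  allFin-increasing : AllPairs Fin._<_ (allFin N)
  allFin-increasing = tabulate⁺-< id

  BestAccepted⇒ : ∀ σ → σ ↭ allFin N → BestAccepted m σ → 1ℚ ≤ ALG (δ 0F) 2 (suc m) σ
  BestAccepted⇒ σ σ↭ (x , x≤ , x∈) with All.lookup x≤ (∈-resp-↭ (↭-sym σ↭) (∈-allFin 0F))
  BestAccepted⇒ σ σ↭ (zero , x≤ , x∈) | _ = ∈⇒1≤sum x∈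

  SecondAccepted⇒ : ∀ σ → σ ↭ allFin N → SecondAccepted m σ → 1ℚ ≤ ALG (δ 1F) 2 (suc m) σ
  SecondAccepted⇒ σ σ↭ (x , y , x<y , all , y∈)
    with All.lookup all (∈-resp-↭ (↭-sym σ↭) (∈-allFin 0F)) | All.lookup all (∈-resp-↭ (↭-sym σ↭) (∈-allFin 1F))
  ... | inj₂ y≤0  | _          = contradiction (ℕ.<-≤-trans x<y y≤0) λ ()
  SecondAccepted⇒ σ σ↭ (zero , suc zero , x<y , all , y∈) | inj₁ refl | inj₂ _ = ∈⇒1≤sum y∈
  SecondAccepted⇒ σ σ↭ (zero , suc (suc y) , x<y , all , y∈) | inj₁ refl | inj₂ (s≤s ())

  expectedALG-≥ : ∀ {π₁ π₂} (v : Fin N → ℚ) → Positive v →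
    Likely {N} N (BestAccepted m) π₁ → Likely {N} N (SecondAccepted m) π₂ →
    v 0F * π₁ + v 1F * π₂ ≤ expectedALG N v 2 (suc m)
  expectedALG-≥ {π₁} {π₂} v v>0 L₁ L₂ = begin
    v 0F * π₁ + v 1F * π₂
      ≡⟨ scaled ⟨
    w * (v 0F * (ι (N !) * π₁) + v 1F * (ι (N !) * π₂))
      ≤⟨ *-monoˡ w≥0 (ℚ.+-mono-≤ (*-monoˡ (ℚ.<⇒≤ (v>0 0F)) best) (*-monoˡ (ℚ.<⇒≤ (v>0 1F)) second)) ⟩
    w * (v 0F * sumOver P (ALG (δ 0F) 2 (suc m)) + v 1F * sumOver P (ALG (δ 1F) 2 (suc m)))
      ≡⟨ cong (w *_) (trans (sumOver-distrib-+ P _ _) (cong₂ _+_ (*-distribˡ-sumOver P (v 0F) _) (*-distribˡ-sumOver P (v 1F) _))) ⟨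
    w * sumOver P (λ σ → v 0F * ALG (δ 0F) 2 (suc m) σ + v 1F * ALG (δ 1F) 2 (suc m) σ)
      ≤⟨ *-monoˡ w≥0 (sumOver-mono P (λ σ → sum-value-≥ v v>0 (optimistic 2 (suc m) σ))) ⟩
    w * sumOver P (ALG v 2 (suc m)) ∎
    where
    open ℚ.≤-Reasoning
    P = arrivalOrders N
    w = ℚ._/_ (+ 1) (N !) {{N !≢0}}
    w-inverse : ∀ k .{{_ : ℕ.NonZero k}} → ι k * (+ 1 ℚ./ k) ≡ 1ℚ
    w-inverse (suc k) = trans (cong (ι (suc k) *_) (1/≡inv k)) (ι-inv k)
    w≥0 : 0ℚ ≤ w
    w≥0 = ℚ.nonNegative⁻¹ w {{ℚ.normalize-nonNeg 1 (N !) {{N !≢0}}}}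
    best : ι (N !) * π₁ ≤ sumOver P (ALG (δ 0F) 2 (suc m))
    best = L₁ (allFin N) allFin-increasing (length-tabulate id) (ALG (δ 0F) 2 (suc m))
      (λ σ → sum-≥0 (δ 0F) (δ≥0 0F) (optimistic 2 (suc m) σ)) BestAccepted⇒
    second : ι (N !) * π₂ ≤ sumOver P (ALG (δ 1F) 2 (suc m))
    second = L₂ (allFin N) allFin-increasing (length-tabulate id) (ALG (δ 1F) 2 (suc m))
      (λ σ → sum-≥0 (δ 1F) (δ≥0 1F) (optimistic 2 (suc m) σ)) SecondAccepted⇒
    scaled : w * (v 0F * (ι (N !) * π₁) + v 1F * (ι (N !) * π₂)) ≡ v 0F * π₁ + v 1F * π₂
    scaled = trans (solve 6 (λ w f a b x y → w :* (a :* (f :* x) :+ b :* (f :* y)) := f :* w :* (a :* x :+ b :* y)) refl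
        w (ι (N !)) (v 0F) (v 1F) π₁ π₂)
      (trans (cong (_* (v 0F * π₁ + v 1F * π₂)) (w-inverse (N !) {{N !≢0}})) (ℚ.*-identityˡ _))
      where
      open +-*-Solver

-- Assembly of the competitive ratio

-- The difference of the two sides is (a - b)(x - t) + b (x + y - 2t). Thus y may lie below t, as it
-- does for the second best item. The summand 0 matches the unfolded `OPT`.
chebyshev-≥ : ∀ {t x y a b} → b ≤ a → 0ℚ ≤ b → t ≤ x → t + t ≤ x + y → t * (a + (b + 0ℚ)) ≤ a * x + b * y
chebyshev-≥ {t} {x} {y} {a} {b} b≤a 0≤b t≤x 2t≤x+y = ≤-from-difference ((a - b) * (x - t) + b * (x + y - (t + t)))
  (solve 5 (λ t x y a b → a :* x :+ b :* y := t :* (a :+ (b :+ con 0ℚ)) :+ ((a :- b) :* (x :- t) :+ b :* (x :+ y :- (t :+ t)))) refl t x y a b)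
  (ℚ.+-mono-≤ (*≥0 (sub-≥0 b≤a) (sub-≥0 t≤x)) (*≥0 0≤b (sub-≥0 2t≤x+y)))
  where
  open +-*-Solver

competitive : ∀ μ k p → size μ ≡ suc (p ℕ.+ 3520 ℕ.* suc p) → suc k ≡ 6479 ℕ.* suc p →
  10000 ℕ.* size μ ≡ 3521 ℕ.* (size μ ℕ.+ suc k) → (v : Fin (size μ ℕ.+ suc k) → ℚ) → StrictlyDecreasing v → Positive v →
  τ * OPT v 2 ≤ expectedALG (size μ ℕ.+ suc k) v 2 (suc (size μ))
competitive μ k p m≡ k≡ ratio v v↘ v>0 = ℚ.≤-trans
  (chebyshev-≥ {τ} (ℚ.<⇒≤ (v↘ zero (suc zero) (s≤s z≤n))) (ℚ.<⇒≤ (v>0 (suc zero)))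
    (ℚ.≤-trans τ≤best (π₁-bound μ k p m≡ k≡ ratio))
    (ℚ.≤-trans 2τ≤best+second (ℚ.+-mono-≤ (π₁-bound μ k p m≡ k≡ ratio) (π₂-bound μ k p m≡ k≡ ratio))))
  (expectedALG-≥ (size μ) v v>0 (Likely-BestAccepted μ (suc k)) (Likely-SecondAccepted μ k))

-- The equations for s and t keep the literals 10000 and 3521 folded: comparing
-- 10000 ℕ.* m with (suc a ℕ.+ b) ℕ.* m would unfold the product.
sizes : ∀ {s t} a b {n m′} → s ≡ suc a ℕ.+ b → t ≡ suc a → 1 ℕ.≤ a → 1 ℕ.≤ b → Coprime s t →
  1 ℕ.≤ n → s ℕ.* m′ ≡ t ℕ.* n →
  ∃[ μ ] ∃[ k ] ∃[ p ] m′ ≡ size μ × n ≡ size μ ℕ.+ suc k × size μ ≡ suc (p ℕ.+ a ℕ.* suc p) × suc k ≡ b ℕ.* suc p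
sizes a b {n} {m′} refl refl 1≤a 1≤b coprime 1≤n ratio
  with coprime-divisor coprime (divides m′ (trans (sym ratio) (ℕ.*-comm (suc a ℕ.+ b) m′)))
-- The ratio alone admits n = m = 0, hence the bound N = 1 in the theorem; otherwise the quotient
-- `suc p` is n/10000.
... | divides zero    n≡ = contradiction (subst (1 ℕ.≤_) n≡ 1≤n) λ ()
... | divides (suc p) n≡ = μ , k , p , sym m≡m′ , n≡m+k , trans m≡m′ m′≡ , k≡
  where
  m′≡ : m′ ≡ suc a ℕ.* suc p
  m′≡ = ℕ.*-cancelˡ-≡ m′ (suc a ℕ.* suc p) (suc a ℕ.+ b) (begin
    (suc a ℕ.+ b) ℕ.* m′                ≡⟨ ratio ⟩
    suc a ℕ.* n                         ≡⟨ cong (suc a ℕ.*_) n≡ ⟩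
    suc a ℕ.* (suc p ℕ.* (suc a ℕ.+ b)) ≡⟨ ℕ.*-assoc (suc a) (suc p) (suc a ℕ.+ b) ⟨
    suc a ℕ.* suc p ℕ.* (suc a ℕ.+ b)   ≡⟨ ℕ.*-comm (suc a ℕ.* suc p) (suc a ℕ.+ b) ⟩
    (suc a ℕ.+ b) ℕ.* (suc a ℕ.* suc p) ∎)
    where
    open ≡-Reasoning
  μ k : ℕ
  μ = m′ ℕ.∸ 2
  k = b ℕ.* suc p ℕ.∸ 1
  m≡m′ : size μ ≡ m′
  m≡m′ = ℕ.m+[n∸m]≡n (subst (2 ℕ.≤_) (sym m′≡) (ℕ.≤-trans (s≤s 1≤a) (ℕ.m≤m*n (suc a) (suc p))))
  k≡ : suc k ≡ b ℕ.* suc p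
  k≡ = ℕ.m+[n∸m]≡n (ℕ.≤-trans 1≤b (ℕ.m≤m*n b (suc p)))
  n≡m+k : n ≡ size μ ℕ.+ suc k
  n≡m+k = trans n≡ (trans (ℕ.*-comm (suc p) (suc a ℕ.+ b)) (trans (ℕ.*-distribʳ-+ (suc p) (suc a) b)
    (cong₂ ℕ._+_ (sym (trans m≡m′ m′≡)) (sym k≡))))

coprime : Coprime 10000 3521
coprime = from-yes (coprime? 10000 3521)

weaken-ratio : ∀ t {ε x y} → 0ℚ < ε → 0ℚ ≤ x → t * x ≤ y → (t - ε) * x ≤ y
weaken-ratio t {ε} {x} ε>0 x≥0 = ℚ.≤-trans (ℚ.*-monoʳ-≤-nonNeg x {{ℚ.nonNegative x≥0}}
  (≤-from-difference {t - ε} {t} ε (solve 2 (λ t e → t := t :- e :+ e) refl t ε) (ℚ.<⇒≤ ε>0)))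
  where
  open +-*-Solver

competitive′ : ∀ n m′ →
  (∃[ μ ] ∃[ k ] ∃[ p ] m′ ≡ size μ × n ≡ size μ ℕ.+ suc k × size μ ≡ suc (p ℕ.+ 3520 ℕ.* suc p) × suc k ≡ 6479 ℕ.* suc p) →
  10000 ℕ.* m′ ≡ 3521 ℕ.* n → (v : Fin n → ℚ) → StrictlyDecreasing v → Positive v →
  0ℚ ≤ OPT v 2 × τ * OPT v 2 ≤ expectedALG n v 2 (suc m′)
competitive′ n m′ (μ , k , p , refl , refl , m≡ , k≡) ratio v v↘ v>0 =
  ℚ.+-mono-≤ (ℚ.<⇒≤ (v>0 zero)) (ℚ.+-mono-≤ (ℚ.<⇒≤ (v>0 (suc zero))) (ℚ.≤-refl {0ℚ})) ,
  competitive μ k p m≡ k≡ ratio v v↘ v>0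

theorem15 : ∀ (ε : ℚ) → 0ℚ ℚ.< ε →
    ∃[ N ] ∀ (n m : ℕ) → N ℕ.≤ n → 10000 ℕ.* m ≡ 3521 ℕ.* n →
    ∀ (v : Fin n → ℚ) → StrictlyDecreasing v → Positive v →
    ((+ 4168 ℚ./ 10000) ℚ.- ε) ℚ.* OPT v 2 ℚ.≤ expectedALG n v 2 (suc m)
theorem15 ε ε>0 = 1 , λ n m 1≤n ratio v v↘ v>0 →
  let OPT≥0 , bound = competitive′ n m (sizes {10000} {3521} 3520 6479 refl refl (s≤s z≤n) (s≤s z≤n) coprime 1≤n ratio) ratio v v↘ v>0
  in weaken-ratio (+ 4168 ℚ./ 10000) ε>0 OPT≥0 bound
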